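{- Let $n,k,d\ge 1$ be integers, let $\chi$ be a Dirichlet character with conductor $d$, let $a,b$ be positive real numbers, let $\beta\in\mathbb{C}$, and let $x\in\mathbb{R}$. Then $$y_{n,\chi,\beta}(x:k,a,b)=d^{\,n-k}\sum_{j=0}^{d-1}\chi(j)\left(\frac{\beta}{a}\right)^{bj}y_{n,\beta^{d}}\left(\frac{x+j}{d}:k,a^{d},b\right).$$
   Context: For an integer $k\ge 1$, reals $a,b>0$, $\beta\in\mathbb{C}$ and $x\in\mathbb{R}$, the polynomials $y_{n,\beta}(x:k,a,b)$ ($n\ge 0$) are defined by the power series expansion at $t=0$ $$\frac{2\left(\frac{t}{2}\right)^{k}}{\beta^{b}e^{t}-a^{b}}\,e^{xt}=\sum_{n=0}^{\infty}y_{n,\beta}(x:k,a,b)\frac{t^{n}}{n!}.$$ For a Dirichlet character $\chi$ with conductor $d$ (regarded as a $d$-periodic function on $\mathbb{Z}$), the generalized polynomials $y_{n,\chi,\beta}(x:k,a,b)$ are defined by the power series expansion at $t=0$ $$2\left(\frac{t}{2}\right)^{k}\sum_{j=0}^{d-1}\frac{\chi(j)\left(\frac{\beta}{a}\right)^{bj}e^{(x+j)t}}{\beta^{bd}e^{dt}-a^{bd}}=\sum_{n=0}^{\infty}y_{n,\chi,\beta}(x:k,a,b)\frac{t^{n}}{n!}.$$ Complex powers are taken with respect to one fixed choice of $\log\beta$: $\beta^{s}=\exp(s\log\beta)$ and $(\beta/a)^{s}=\beta^s/a^s$ for real $s\ge 0$, and for the parameter $\beta^d$ one uses $(\beta^d)^b=\beta^{bd}$;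 if $\beta=0$ then $0^s=0$ for $s>0$ and $0^0=1$. -}

module Defs where

open import Algebra.Bundles using (CommutativeRing; RawSemiring; Semiring)
import Algebra.Definitions.RawSemiring
import Algebra.Properties.CommutativeSemiring.Exp
import Algebra.Solver.Ring as RingSolver
open import Algebra.Solver.Ring.AlmostCommutativeRing
  using (fromCommutativeRing; _-Raw-AlmostCommutative⟶_; Induced-equivalence)
open import Data.Bool.Base using (if_then_else_)
open import Data.Fin.Base using (Fin; toℕ)
open import Data.Integer.Base as ℤ using (ℤ; +_; -[1+_]; +[1+_])
import Data.Integer.Coprimality as ℤ
import Data.Integer.Divisibility as ℤ
import Data.Integer.Properties as ℤ
open import Data.Maybe.Base using (just; nothing)
open import Data.Nat.Base as ℕ using (ℕ; zero; suc)
import Data.Nat.Divisibility as ℕ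
import Data.Nat.Properties as ℕ
open import Data.Product.Base using (∃; _×_; _,_; proj₁; proj₂)
open import Data.Rational.Base as ℚ
  using (ℚ; mkℚ; 0ℚ; 1ℚ; ½; _/_; _+_; _*_; -_; _-_; _≤_; _<_; ∣_∣; *<*; *≤*)
import Data.Rational.Properties as ℚ
import Data.Rational.Solver
import Data.Rational.Unnormalised.Base as ℚᵘ
import Data.Rational.Unnormalised.Properties as ℚᵘ
open import Data.Sum.Base using (inj₁; inj₂)
open import Function.Base using (_∘_; id)
open import Level using (0ℓ)
open import Relation.Binary.Definitions using (WeaklyDecidable)
open import Relation.Binary.PropositionalEquality
  using (_≡_; refl; sym; trans; cong; cong₂; subst; subst₂; module ≡-Reasoning)
import Relation.Binary.Reasoning.Setoid
open import Relation.Binary.Structures using (IsEquivalence)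
open import Relation.Nullary using (Dec; yes; no; does; ¬_)

open Data.Rational.Solver.+-*-Solver using (solve; _:+_; _:*_; _:-_; :-_; con; _:=_)

open import Algebra.Properties.CommutativeSemiring.Exp
  (CommutativeRing.commutativeSemiring ℚ.+-*-commutativeRing) public
  using () renaming (_^_ to _^ℚ_; ^-assocʳ to ^ℚ-assocʳ; ^-homo-* to ^ℚ-homo-*; ^-distrib-* to ^ℚ-distrib-*)

fromℕ : ℕ → ℚ
fromℕ n = + n / 1

1/1+ : ℕ → ℚ
1/1+ n = + 1 / suc n

*-mono : ∀ {p q r s} → 0ℚ ≤ p → 0ℚ ≤ r → p ≤ q → r ≤ s → p * r ≤ q * s
*-mono {p} {q} {r} {s} 0≤p 0≤r p≤q r≤s = ℚ.≤-trans
  (ℚ.*-monoʳ-≤-nonNeg r {{ℚ.nonNegative 0≤r}} p≤q)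
  (ℚ.*-monoˡ-≤-nonNeg q {{ℚ.nonNegative (ℚ.≤-trans 0≤p p≤q)}} r≤s)

*-nonNeg : ∀ {p q} → 0ℚ ≤ p → 0ℚ ≤ q → 0ℚ ≤ p * q
*-nonNeg {p} {q} 0≤p 0≤q = ℚ.nonNegative⁻¹ _
  {{ℚ.nonNeg*nonNeg⇒nonNeg p {{ℚ.nonNegative 0≤p}} q {{ℚ.nonNegative 0≤q}}}}

*-pos : ∀ {p q} → 0ℚ < p → 0ℚ < q → 0ℚ < p * q
*-pos {p} {q} 0<p 0<q = ℚ.positive⁻¹ _
  {{ℚ.pos*pos⇒pos p {{ℚ.positive 0<p}} q {{ℚ.positive 0<q}}}}

+-nonNeg : ∀ {p q} → 0ℚ ≤ p → 0ℚ ≤ q → 0ℚ ≤ p + q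
+-nonNeg = ℚ.+-mono-≤

≤-+ˡ : ∀ {p q} → 0ℚ ≤ q → p ≤ p + q
≤-+ˡ {p} {q} 0≤q = subst (_≤ p + q) (ℚ.+-identityʳ p) (ℚ.+-monoʳ-≤ p 0≤q)

≤-+ʳ : ∀ {p q} → 0ℚ ≤ p → q ≤ p + q
≤-+ʳ {p} {q} 0≤p = subst (_≤ p + q) (ℚ.+-identityˡ q) (ℚ.+-monoˡ-≤ q 0≤p)

0≤1 : 0ℚ ≤ 1ℚ
0≤1 = ℚ.nonNegative⁻¹ 1ℚ

0≤p-q : ∀ {p q} → q ≤ p → 0ℚ ≤ p - q
0≤p-q {p} {q} q≤p = subst (_≤ p - q) (ℚ.+-inverseʳ q) (ℚ.+-monoˡ-≤ (- q) q≤p)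

p-q≤ : ∀ {p q r} → p ≤ q + r → p - q ≤ r
p-q≤ {p} {q} {r} h = subst (p - q ≤_)
  (solve 2 (λ q r → q :+ r :- q := r) refl q r) (ℚ.+-monoˡ-≤ (- q) h)

p≤∣p∣ : ∀ p → p ≤ ∣ p ∣
p≤∣p∣ p with ℚ.≤-total 0ℚ p
... | inj₁ 0≤p = ℚ.≤-reflexive (sym (ℚ.0≤p⇒∣p∣≡p 0≤p))
... | inj₂ p≤0 = ℚ.≤-trans p≤0 (ℚ.0≤∣p∣ p)

∣p-q∣≡∣q-p∣ : ∀ p q → ∣ p - q ∣ ≡ ∣ q - p ∣
∣p-q∣≡∣q-p∣ p q = trans (cong ∣_∣ (solve 2 (λ p q → p :- q := :- (q :- p)) refl p q))
  (ℚ.∣-p∣≡∣p∣ (q - p))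

p*p≥0 : ∀ p → 0ℚ ≤ p * p
p*p≥0 p = subst (0ℚ ≤_) (abs-sq p) (*-nonNeg (ℚ.0≤∣p∣ p) (ℚ.0≤∣p∣ p))
  where
  abs-sq : ∀ p → ∣ p ∣ * ∣ p ∣ ≡ p * p
  abs-sq p with ℚ.∣p∣≡p∨∣p∣≡-p p
  ... | inj₁ e rewrite e = refl
  ... | inj₂ e rewrite e = solve 1 (λ p → (:- p) :* (:- p) := p :* p) refl p

fromℕ-+ : ∀ m n → fromℕ (m ℕ.+ n) ≡ fromℕ m + fromℕ n
fromℕ-+ m n = ℚ.toℚᵘ-injective (begin
  ℚ.toℚᵘ (fromℕ (m ℕ.+ n))             ≈⟨ ℚ.toℚᵘ-fromℚᵘ (ℚᵘ.mkℚᵘ (+ (m ℕ.+ n)) 0) ⟩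
  ℚᵘ.mkℚᵘ (+ (m ℕ.+ n)) 0              ≈⟨ ℚᵘ.*≡* (cong (ℤ._* + 1) (cong₂ ℤ._+_ (sym (ℤ.*-identityʳ (+ m))) (sym (ℤ.*-identityʳ (+ n))))) ⟩
  ℚᵘ.mkℚᵘ (+ m) 0 ℚᵘ.+ ℚᵘ.mkℚᵘ (+ n) 0 ≈⟨ ℚᵘ.+-cong (ℚ.toℚᵘ-fromℚᵘ (ℚᵘ.mkℚᵘ (+ m) 0)) (ℚ.toℚᵘ-fromℚᵘ (ℚᵘ.mkℚᵘ (+ n) 0)) ⟨
  ℚ.toℚᵘ (fromℕ m) ℚᵘ.+ ℚ.toℚᵘ (fromℕ n) ≈⟨ ℚ.toℚᵘ-homo-+ (fromℕ m) (fromℕ n) ⟨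
  ℚ.toℚᵘ (fromℕ m + fromℕ n)           ∎)
  where open ℚᵘ.≃-Reasoning

fromℕ-* : ∀ m n → fromℕ (m ℕ.* n) ≡ fromℕ m * fromℕ n
fromℕ-* zero    n = sym (ℚ.*-zeroˡ (fromℕ n))
fromℕ-* (suc m) n = begin
  fromℕ (n ℕ.+ m ℕ.* n)          ≡⟨ fromℕ-+ n (m ℕ.* n) ⟩
  fromℕ n + fromℕ (m ℕ.* n)      ≡⟨ cong (fromℕ n ℚ.+_) (fromℕ-* m n) ⟩
  fromℕ n + fromℕ m * fromℕ n    ≡⟨ solve 2 (λ m n → n :+ m :* n := (con 1ℚ :+ m) :* n) refl (fromℕ m) (fromℕ n) ⟩
  (1ℚ + fromℕ m) * fromℕ n       ≡⟨ cong (_* fromℕ n) (fromℕ-+ 1 m) ⟨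
  fromℕ (suc m) * fromℕ n        ∎
  where open ≡-Reasoning

0≤fromℕ : ∀ n → 0ℚ ≤ fromℕ n
0≤fromℕ n = ℚ.nonNegative⁻¹ _ {{ℚ.normalize-nonNeg n 1}}

0<1/1+ : ∀ n → 0ℚ < 1/1+ n
0<1/1+ n = ℚ.positive⁻¹ _ {{ℚ.normalize-pos 1 (suc n)}}

0≤1/1+ : ∀ n → 0ℚ ≤ 1/1+ n
0≤1/1+ n = ℚ.<⇒≤ (0<1/1+ n)

1/-inverse : ∀ m n → .{{_ : ℕ.NonZero n}} → (+ m / n) * fromℕ n ≡ fromℕ m
1/-inverse m n@(suc n-1) = ℚ.toℚᵘ-injective (begin
  ℚ.toℚᵘ ((+ m / n) * fromℕ n)             ≈⟨ ℚ.toℚᵘ-homo-* (+ m / n) (fromℕ n) ⟩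
  ℚ.toℚᵘ (+ m / n) ℚᵘ.* ℚ.toℚᵘ (fromℕ n)   ≈⟨ ℚᵘ.*-cong (ℚ.toℚᵘ-fromℚᵘ (ℚᵘ.mkℚᵘ (+ m) n-1)) (ℚ.toℚᵘ-fromℚᵘ (ℚᵘ.mkℚᵘ (+ n) 0)) ⟩
  ℚᵘ.mkℚᵘ (+ m) n-1 ℚᵘ.* ℚᵘ.mkℚᵘ (+ n) 0   ≈⟨ ℚᵘ.*≡* (trans (ℤ.*-identityʳ _) (cong (λ k → + m ℤ.* + k) (sym (ℕ.*-identityʳ n)))) ⟩
  ℚᵘ.mkℚᵘ (+ m) 0                          ≈⟨ ℚ.toℚᵘ-fromℚᵘ (ℚᵘ.mkℚᵘ (+ m) 0) ⟨
  ℚ.toℚᵘ (fromℕ m)                         ∎)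
  where open ℚᵘ.≃-Reasoning

[1+n]/[1+n] : ∀ n → fromℕ (suc n) * 1/1+ n ≡ 1ℚ
[1+n]/[1+n] n = trans (ℚ.*-comm (fromℕ (suc n)) (1/1+ n)) (1/-inverse 1 (suc n))

fromℕ-mono : ∀ {m n} → m ℕ.≤ n → fromℕ m ≤ fromℕ n
fromℕ-mono {m} {n} m≤n = subst (λ k → fromℕ m ≤ fromℕ k) (ℕ.m+[n∸m]≡n m≤n)
  (subst (fromℕ m ≤_) (sym (fromℕ-+ m (n ℕ.∸ m))) (≤-+ˡ (0≤fromℕ (n ℕ.∸ m))))

1/1+-anti : ∀ {m n} → m ℕ.≤ n → 1/1+ n ≤ 1/1+ m
1/1+-anti {m} {n} m≤n = subst₂ _≤_
  (trans (cong (_* 1/1+ n) ([1+n]/[1+n] m)) (ℚ.*-identityˡ (1/1+ n)))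
  (begin
    fromℕ (suc n) * 1/1+ m * 1/1+ n    ≡⟨ solve 3 (λ a b c → a :* b :* c := b :* (a :* c)) refl (fromℕ (suc n)) (1/1+ m) (1/1+ n) ⟩
    1/1+ m * (fromℕ (suc n) * 1/1+ n)  ≡⟨ cong (1/1+ m *_) ([1+n]/[1+n] n) ⟩
    1/1+ m * 1ℚ                        ≡⟨ ℚ.*-identityʳ (1/1+ m) ⟩
    1/1+ m                             ∎)
  (ℚ.*-monoʳ-≤-nonNeg (1/1+ n) {{ℚ.nonNegative (0≤1/1+ n)}}
    (ℚ.*-monoʳ-≤-nonNeg (1/1+ m) {{ℚ.nonNegative (0≤1/1+ m)}} (fromℕ-mono (ℕ.s≤s m≤n))))
  where open ≡-Reasoning

1/1+-* : ∀ m n → 1/1+ m * 1/1+ n ≡ 1/1+ (n ℕ.+ m ℕ.* suc n)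
1/1+-* m n = begin
  a * b                    ≡⟨ ℚ.*-identityʳ (a * b) ⟨
  a * b * 1ℚ               ≡⟨ cong (a * b *_) (trans (cong (_* c) (sym (fromℕ-* (suc m) (suc n)))) ([1+n]/[1+n] (n ℕ.+ m ℕ.* suc n))) ⟨
  a * b * (M * N * c)      ≡⟨ solve 5 (λ a b M N c → a :* b :* (M :* N :* c) := (M :* a) :* (N :* b) :* c) refl a b M N c ⟩
  (M * a) * (N * b) * c    ≡⟨ cong₂ (λ x y → x * y * c) ([1+n]/[1+n] m) ([1+n]/[1+n] n) ⟩
  1ℚ * 1ℚ * c              ≡⟨ solve 1 (λ c → con 1ℚ :* con 1ℚ :* c := c) refl c ⟩
  c                        ∎
  where
  open ≡-Reasoning
  a = 1/1+ m
  b = 1/1+ n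
  c = 1/1+ (n ℕ.+ m ℕ.* suc n)
  M = fromℕ (suc m)
  N = fromℕ (suc n)

archimedean : ∀ {δ} → 0ℚ < δ → ∃ λ N → 1/1+ N < δ
archimedean {mkℚ (+ zero)  q c} (*<* (ℤ.+<+ ()))
archimedean {mkℚ -[1+ p ] q c} (*<* ())
archimedean {δ@(mkℚ +[1+ p ] q c)} 0<δ = suc q , (begin-strict
  1/1+ (suc q)                                ≡⟨ ℚ.*-identityʳ _ ⟨
  1/1+ (suc q) * 1ℚ                           <⟨ ℚ.*-monoʳ-<-pos (1/1+ (suc q)) {{ℚ.positive (0<1/1+ (suc q))}} 1<Mδ ⟩
  1/1+ (suc q) * (fromℕ (suc (suc q)) * δ)    ≡⟨ ℚ.*-assoc (1/1+ (suc q)) (fromℕ (suc (suc q))) δ ⟨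
  1/1+ (suc q) * fromℕ (suc (suc q)) * δ      ≡⟨ cong (_* δ) (1/-inverse 1 (suc (suc q))) ⟩
  1ℚ * δ                                      ≡⟨ ℚ.*-identityˡ δ ⟩
  δ                                           ∎)
  where
  open ℚ.≤-Reasoning
  δ≡ : δ ≡ + suc p / suc q
  δ≡ = sym (ℚ.↥p/↧p≡p δ)
  1≤Qδ : 1ℚ ≤ fromℕ (suc q) * δ
  1≤Qδ = begin
    1ℚ                                 ≤⟨ fromℕ-mono {1} {suc p} (ℕ.s≤s ℕ.z≤n) ⟩
    fromℕ (suc p)                      ≡⟨ 1/-inverse (suc p) (suc q) ⟨
    (+ suc p / suc q) * fromℕ (suc q)  ≡⟨ ℚ.*-comm (+ suc p / suc q) (fromℕ (suc q)) ⟩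
    fromℕ (suc q) * (+ suc p / suc q)  ≡⟨ cong (fromℕ (suc q) *_) δ≡ ⟨
    fromℕ (suc q) * δ                  ∎
  1<Mδ : 1ℚ < fromℕ (suc (suc q)) * δ
  1<Mδ = begin-strict
    1ℚ                          ≤⟨ 1≤Qδ ⟩
    fromℕ (suc q) * δ           ≡⟨ ℚ.+-identityʳ _ ⟨
    fromℕ (suc q) * δ + 0ℚ      <⟨ ℚ.+-monoʳ-< (fromℕ (suc q) * δ) 0<δ ⟩
    fromℕ (suc q) * δ + δ       ≡⟨ solve 2 (λ a d → a :* d :+ d := (con 1ℚ :+ a) :* d) refl (fromℕ (suc q)) δ ⟩
    (1ℚ + fromℕ (suc q)) * δ    ≡⟨ cong (_* δ) (fromℕ-+ 1 (suc q)) ⟨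
    fromℕ (suc (suc q)) * δ     ∎

≤-fromℕ : ∀ p → ∃ λ n → p ≤ fromℕ n
≤-fromℕ p@(mkℚ n q _) = ℤ.∣ n ∣ , (begin
  p                                 ≤⟨ p≤∣p∣ p ⟩
  ∣ p ∣                             ≡⟨ ℚ.↥p/↧p≡p ∣ p ∣ ⟨
  r                                 ≡⟨ ℚ.*-identityʳ r ⟨
  r * fromℕ 1                       ≤⟨ ℚ.*-monoˡ-≤-nonNeg r {{ℚ.normalize-nonNeg ℤ.∣ n ∣ (suc q)}} (fromℕ-mono {1} {suc q} (ℕ.s≤s ℕ.z≤n)) ⟩
  r * fromℕ (suc q)                 ≡⟨ 1/-inverse ℤ.∣ n ∣ (suc q) ⟩
  fromℕ ℤ.∣ n ∣                     ∎)
  where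
  open ℚ.≤-Reasoning
  r = + ℤ.∣ n ∣ / suc q

^-nonNeg : ∀ {p} n → 0ℚ ≤ p → 0ℚ ≤ p ^ℚ n
^-nonNeg zero    _   = 0≤1
^-nonNeg (suc n) 0≤p = *-nonNeg 0≤p (^-nonNeg n 0≤p)

^-monoˡ : ∀ {p q} n → 0ℚ ≤ p → p ≤ q → p ^ℚ n ≤ q ^ℚ n
^-monoˡ zero    _   _   = ℚ.≤-refl
^-monoˡ (suc n) 0≤p p≤q = *-mono 0≤p (^-nonNeg n 0≤p) p≤q (^-monoˡ n 0≤p p≤q)

1^n : ∀ n → 1ℚ ^ℚ n ≡ 1ℚ
1^n zero    = refl
1^n (suc n) = trans (ℚ.*-identityˡ (1ℚ ^ℚ n)) (1^n n)

1≤^ : ∀ {p} n → 1ℚ ≤ p → 1ℚ ≤ p ^ℚ n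
1≤^ {p} n 1≤p = subst (_≤ p ^ℚ n) (1^n n) (^-monoˡ n 0≤1 1≤p)

^-≤-suc : ∀ {p} n → 1ℚ ≤ p → p ^ℚ n ≤ p ^ℚ suc n
^-≤-suc {p} n 1≤p = subst (_≤ p ^ℚ suc n) (ℚ.*-identityˡ (p ^ℚ n))
  (ℚ.*-monoʳ-≤-nonNeg (p ^ℚ n) {{ℚ.nonNegative (^-nonNeg n (ℚ.≤-trans 0≤1 1≤p))}} 1≤p)

p≤p^suc : ∀ {p} n → 1ℚ ≤ p → p ≤ p ^ℚ suc n
p≤p^suc {p} n 1≤p = subst (_≤ p ^ℚ suc n) (ℚ.*-identityʳ p)
  (ℚ.*-monoˡ-≤-nonNeg p {{ℚ.nonNegative (ℚ.≤-trans 0≤1 1≤p)}} (1≤^ n 1≤p))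

bernoulli : ∀ {x} n → 0ℚ ≤ 1ℚ + x → 1ℚ + fromℕ n * x ≤ (1ℚ + x) ^ℚ n
bernoulli {x} zero    h = ℚ.≤-reflexive (solve 1 (λ x → con 1ℚ :+ con 0ℚ :* x := con 1ℚ) refl x)
bernoulli {x} (suc n) h = begin
  1ℚ + fromℕ (suc n) * x                           ≡⟨ cong (λ k → 1ℚ + k * x) (fromℕ-+ 1 n) ⟩
  1ℚ + (1ℚ + fromℕ n) * x                          ≤⟨ ≤-+ˡ (*-nonNeg (0≤fromℕ n) (p*p≥0 x)) ⟩
  1ℚ + (1ℚ + fromℕ n) * x + fromℕ n * (x * x)      ≡⟨ solve 2 (λ k x → con 1ℚ :+ (con 1ℚ :+ k) :* x :+ k :* (x :* x) := (con 1ℚ :+ x) :* (con 1ℚ :+ k :* x)) refl (fromℕ n) x ⟩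
  (1ℚ + x) * (1ℚ + fromℕ n * x)                    ≤⟨ ℚ.*-monoˡ-≤-nonNeg (1ℚ + x) {{ℚ.nonNegative h}} (bernoulli n h) ⟩
  (1ℚ + x) * (1ℚ + x) ^ℚ n                         ∎
  where open ℚ.≤-Reasoning

-- An upper bound for (1 + b / n) ^ n, uniform in n ≥ 1.
K : ℕ → ℚ
K b = fromℕ 2 ^ℚ (2 ℕ.* b)

0≤K : ∀ b → 0ℚ ≤ K b
0≤K b = ^-nonNeg (2 ℕ.* b) (0≤fromℕ 2)

[1+b/n]^n≤K : ∀ b n → (1ℚ + 1/1+ n * fromℕ b) ^ℚ suc n ≤ K b
[1+b/n]^n≤K b n = begin
  (1ℚ + 1/1+ n * fromℕ b) ^ℚ N      ≡⟨ cong (λ t → (1ℚ + t) ^ℚ N) eq ⟩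
  (1ℚ + fromℕ (2 ℕ.* b) * h) ^ℚ N   ≤⟨ ^-monoˡ N (+-nonNeg 0≤1 (*-nonNeg (0≤fromℕ (2 ℕ.* b)) 0≤h)) (bernoulli (2 ℕ.* b) (+-nonNeg 0≤1 0≤h)) ⟩
  ((1ℚ + h) ^ℚ (2 ℕ.* b)) ^ℚ N      ≡⟨ ^ℚ-assocʳ (1ℚ + h) (2 ℕ.* b) N ⟩
  (1ℚ + h) ^ℚ (2 ℕ.* b ℕ.* N)       ≡⟨ cong ((1ℚ + h) ^ℚ_) (ℕ.*-comm (2 ℕ.* b) N) ⟩
  (1ℚ + h) ^ℚ (N ℕ.* (2 ℕ.* b))     ≡⟨ ^ℚ-assocʳ (1ℚ + h) N (2 ℕ.* b) ⟨
  ((1ℚ + h) ^ℚ N) ^ℚ (2 ℕ.* b)      ≤⟨ ^-monoˡ (2 ℕ.* b) (^-nonNeg N (+-nonNeg 0≤1 0≤h)) base ⟩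
  fromℕ 2 ^ℚ (2 ℕ.* b)              ∎
  where
  open ℚ.≤-Reasoning
  N = suc n
  h = ½ * 1/1+ n
  0≤½ : 0ℚ ≤ ½
  0≤½ = ℚ.nonNegative⁻¹ ½
  0≤h : 0ℚ ≤ h
  0≤h = *-nonNeg 0≤½ (0≤1/1+ n)
  eq : 1/1+ n * fromℕ b ≡ fromℕ (2 ℕ.* b) * h
  eq = trans (solve 2 (λ e b → e :* b := con (fromℕ 2) :* b :* (con ½ :* e)) refl (1/1+ n) (fromℕ b))
             (cong (_* h) (sym (fromℕ-* 2 b)))
  Nh : fromℕ N * h ≡ ½
  Nh = trans (solve 2 (λ N e → N :* (con ½ :* e) := con ½ :* (N :* e)) refl (fromℕ N) (1/1+ n))
             (trans (cong (½ *_) ([1+n]/[1+n] n)) (ℚ.*-identityʳ ½))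
  h≤1 : h ≤ 1ℚ
  h≤1 = *-mono {½} {1ℚ} {1/1+ n} {1/1+ 0} 0≤½ (0≤1/1+ n) (*≤* (ℤ.+≤+ (ℕ.s≤s ℕ.z≤n))) (1/1+-anti {0} {n} ℕ.z≤n)
  0≤1-h : 0ℚ ≤ 1ℚ + - h
  0≤1-h = 0≤p-q h≤1
  ½≤ : ½ ≤ (1ℚ + - h) ^ℚ N
  ½≤ = begin
    ½                         ≡⟨⟩
    1ℚ + - ½                  ≡⟨ cong (λ t → 1ℚ + - t) Nh ⟨
    1ℚ + - (fromℕ N * h)      ≡⟨ cong (1ℚ ℚ.+_) (ℚ.neg-distribʳ-* (fromℕ N) h) ⟩
    1ℚ + fromℕ N * (- h)      ≤⟨ bernoulli N 0≤1-h ⟩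
    (1ℚ + - h) ^ℚ N           ∎
  1-h²≤1 : (1ℚ + h) * (1ℚ + - h) ≤ 1ℚ
  1-h²≤1 = begin
    (1ℚ + h) * (1ℚ + - h)              ≤⟨ ≤-+ˡ (p*p≥0 h) ⟩
    (1ℚ + h) * (1ℚ + - h) + h * h      ≡⟨ solve 1 (λ h → (con 1ℚ :+ h) :* (con 1ℚ :+ :- h) :+ h :* h := con 1ℚ) refl h ⟩
    1ℚ                                 ∎
  base : (1ℚ + h) ^ℚ N ≤ fromℕ 2
  base = begin
    (1ℚ + h) ^ℚ N                                  ≡⟨ solve 1 (λ x → x := con (fromℕ 2) :* (x :* con ½)) refl ((1ℚ + h) ^ℚ N) ⟩
    fromℕ 2 * ((1ℚ + h) ^ℚ N * ½)                  ≤⟨ ℚ.*-monoˡ-≤-nonNeg (fromℕ 2) (ℚ.*-monoˡ-≤-nonNeg ((1ℚ + h) ^ℚ N) {{ℚ.nonNegative (^-nonNeg N (+-nonNeg 0≤1 0≤h))}} ½≤) ⟩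
    fromℕ 2 * ((1ℚ + h) ^ℚ N * (1ℚ + - h) ^ℚ N)    ≡⟨ cong (fromℕ 2 *_) (^ℚ-distrib-* (1ℚ + h) (1ℚ + - h) N) ⟨
    fromℕ 2 * ((1ℚ + h) * (1ℚ + - h)) ^ℚ N         ≤⟨ ℚ.*-monoˡ-≤-nonNeg (fromℕ 2) (^-monoˡ N (*-nonNeg (+-nonNeg 0≤1 0≤h) 0≤1-h) 1-h²≤1) ⟩
    fromℕ 2 * 1ℚ ^ℚ N                              ≡⟨ cong (fromℕ 2 *_) (1^n N) ⟩
    fromℕ 2                                        ∎

-- f i → 0 as h i → ∞, for f ≥ 0.
Small : {I : Set} → (I → ℕ) → (I → ℚ) → Set
Small h f = ∀ {δ} → 0ℚ < δ → ∃ λ N → ∀ i → N ℕ.≤ h i → f i < δ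

min : ℕ × ℕ → ℕ
min (m , n) = m ℕ.⊓ n

module _ {I : Set} {h : I → ℕ} where

  small-dom : ∀ {f g} → ∃ (λ N → ∀ i → N ℕ.≤ h i → f i ≤ g i) → Small h g → Small h f
  small-dom (N₁ , f≤g) g→0 0<δ with g→0 0<δ
  ... | N₂ , g<δ = N₁ ℕ.⊔ N₂ , λ i N≤ → ℚ.≤-<-trans
    (f≤g i (ℕ.≤-trans (ℕ.m≤m⊔n N₁ N₂) N≤)) (g<δ i (ℕ.≤-trans (ℕ.m≤n⊔m N₁ N₂) N≤))

  small-≤ : ∀ {f g} → (∀ i → f i ≤ g i) → Small h g → Small h f
  small-≤ f≤g = small-dom (0 , λ i _ → f≤g i)

  small-+ : ∀ {f g} → Small h f → Small h g → Small h (λ i → f i + g i)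
  small-+ {f} {g} f→0 g→0 {δ} 0<δ = N₁ ℕ.⊔ N₂ , λ i N≤ → subst (f i + g i <_) halves
    (ℚ.+-mono-< (f< i (ℕ.≤-trans (ℕ.m≤m⊔n N₁ N₂) N≤)) (g< i (ℕ.≤-trans (ℕ.m≤n⊔m N₁ N₂) N≤)))
    where
    0<δ/2 : 0ℚ < ½ * δ
    0<δ/2 = *-pos (ℚ.positive⁻¹ ½) 0<δ
    halves : ½ * δ + ½ * δ ≡ δ
    halves = solve 1 (λ d → con ½ :* d :+ con ½ :* d := d) refl δ
    N₁ = proj₁ (f→0 0<δ/2)
    N₂ = proj₁ (g→0 0<δ/2)
    f< = proj₂ (f→0 0<δ/2)
    g< = proj₂ (g→0 0<δ/2)

  small-* : ∀ {f} c → Small h f → Small h (λ i → fromℕ c * f i)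
  small-* {f} c f→0 {δ} 0<δ = N , λ i N≤ → (begin-strict
    fromℕ c * f i                ≤⟨ ℚ.*-monoˡ-≤-nonNeg (fromℕ c) {{ℚ.nonNegative (0≤fromℕ c)}} (ℚ.<⇒≤ (f< i N≤)) ⟩
    fromℕ c * η                  ≡⟨ ℚ.+-identityʳ (fromℕ c * η) ⟨
    fromℕ c * η + 0ℚ             <⟨ ℚ.+-monoʳ-< (fromℕ c * η) 0<η ⟩
    fromℕ c * η + η              ≡⟨ solve 2 (λ a d → a :* d :+ d := (con 1ℚ :+ a) :* d) refl (fromℕ c) η ⟩
    (1ℚ + fromℕ c) * η           ≡⟨ cong (_* η) (fromℕ-+ 1 c) ⟨
    fromℕ (suc c) * η            ≡⟨ ℚ.*-assoc (fromℕ (suc c)) (1/1+ c) δ ⟨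
    fromℕ (suc c) * 1/1+ c * δ   ≡⟨ cong (_* δ) ([1+n]/[1+n] c) ⟩
    1ℚ * δ                       ≡⟨ ℚ.*-identityˡ δ ⟩
    δ                            ∎)
    where
    open ℚ.≤-Reasoning
    η = 1/1+ c * δ
    0<η : 0ℚ < η
    0<η = *-pos (0<1/1+ c) 0<δ
    N = proj₁ (f→0 0<η)
    f< = proj₂ (f→0 0<η)

  small-*ℚ : ∀ {f} p → (∀ i → 0ℚ ≤ f i) → Small h f → Small h (λ i → p * f i)
  small-*ℚ {f} p 0≤f f→0 = small-≤
    (λ i → ℚ.*-monoʳ-≤-nonNeg (f i) {{ℚ.nonNegative (0≤f i)}} (proj₂ (≤-fromℕ p)))
    (small-* {f} (proj₁ (≤-fromℕ p)) f→0)

  small-*ᵇ : ∀ {f g : I → ℚ} → (∀ i → 0ℚ ≤ f i) → ∃ (λ c → ∃ λ N → ∀ i → N ℕ.≤ h i → g i ≤ fromℕ c) →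
             Small h f → Small h (λ i → g i * f i)
  small-*ᵇ {f} {g} 0≤f (c , N , g≤c) f→0 = small-dom
    (N , λ i N≤ → ℚ.*-monoʳ-≤-nonNeg (f i) {{ℚ.nonNegative (0≤f i)}} (g≤c i N≤)) (small-* {f} c f→0)

  small-1/1+ : ∀ {k : I → ℕ} → (∀ i → h i ℕ.≤ k i) → Small h (λ i → 1/1+ (k i))
  small-1/1+ h≤k 0<δ with archimedean 0<δ
  ... | N , 1/N<δ = N , λ i N≤ → ℚ.≤-<-trans (1/1+-anti (ℕ.≤-trans N≤ (h≤k i))) 1/N<δ

small-∘ : ∀ {I J : Set} {h : I → ℕ} {k : J → ℕ} (φ : J → I) → (∀ j → k j ℕ.≤ h (φ j)) →
          ∀ {f} → Small h f → Small k (f ∘ φ)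
small-∘ φ k≤h f→0 0<δ with f→0 0<δ
... | N , f<δ = N , λ j N≤ → f<δ (φ j) (ℕ.≤-trans N≤ (k≤h j))

module ℚ-Solver {c ℓ} (R : CommutativeRing c ℓ)
  (morphism : CommutativeRing.rawRing ℚ.+-*-commutativeRing
              -Raw-AlmostCommutative⟶ fromCommutativeRing R) where
  private
    open CommutativeRing R
    open _-Raw-AlmostCommutative⟶_ morphism
    ℚ-≟ : WeaklyDecidable (Induced-equivalence morphism)
    ℚ-≟ p q with p ℚ.≟ q
    ... | yes refl = just (CommutativeRing.refl R {⟦ p ⟧})
    ... | no _     = nothing
  open RingSolver (CommutativeRing.rawRing ℚ.+-*-commutativeRing) (fromCommutativeRing R)
    morphism ℚ-≟ public

record NormedℚAlgebra : Set₁ where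
  field
    ring     : CommutativeRing 0ℓ 0ℓ
    morphism : CommutativeRing.rawRing ℚ.+-*-commutativeRing
               -Raw-AlmostCommutative⟶ fromCommutativeRing ring
  private module R = CommutativeRing ring
  open R using (Carrier; _≈_)
  open _-Raw-AlmostCommutative⟶_ morphism
  field
    ‖_‖        : Carrier → ℚ
    ‖‖-cong    : ∀ {x y} → x ≈ y → ‖ x ‖ ≡ ‖ y ‖
    0≤‖_‖      : ∀ x → 0ℚ ≤ ‖ x ‖
    ‖x+y‖≤     : ∀ x y → ‖ x R.+ y ‖ ≤ ‖ x ‖ + ‖ y ‖
    ‖x*y‖≤     : ∀ x y → ‖ x R.* y ‖ ≤ ‖ x ‖ * ‖ y ‖
    ‖p‖≡∣p∣    : ∀ p → ‖ ⟦ p ⟧ ‖ ≡ ∣ p ∣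

module Compound (𝒜 : NormedℚAlgebra) where
  open NormedℚAlgebra 𝒜
  open _-Raw-AlmostCommutative⟶_ morphism renaming (⟦_⟧ to ι) using (1-homo; +-homo; *-homo) public
  private
    module R = CommutativeRing ring
    module S = ℚ-Solver ring morphism
  open R using (Carrier; _≈_)
  open import Algebra.Properties.CommutativeSemiring.Exp R.commutativeSemiring public

  compound : ℕ → Carrier → Carrier
  compound n z = (ι 1ℚ R.+ ι (1/1+ n) R.* z) ^ suc n

  dist : Carrier → Carrier → ℚ
  dist x y = ‖ x R.- y ‖

  private
    ‖p‖≡p : ∀ {p} → 0ℚ ≤ p → ‖ ι p ‖ ≡ p
    ‖p‖≡p {p} 0≤p = trans (‖p‖≡∣p∣ p) (ℚ.0≤p⇒∣p∣≡p 0≤p)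

    ‖ιp*x‖≤ : ∀ {p x b} → 0ℚ ≤ p → ‖ x ‖ ≤ b → ‖ ι p R.* x ‖ ≤ p * b
    ‖ιp*x‖≤ {p} {x} 0≤p x≤b = ℚ.≤-trans (‖x*y‖≤ (ι p) x)
      (*-mono 0≤‖ ι p ‖ 0≤‖ x ‖ (ℚ.≤-reflexive (‖p‖≡p 0≤p)) x≤b)

    ‖x*y‖≤pq : ∀ {x y p q} → ‖ x ‖ ≤ p → ‖ y ‖ ≤ q → ‖ x R.* y ‖ ≤ p * q
    ‖x*y‖≤pq {x} {y} x≤p y≤q = ℚ.≤-trans (‖x*y‖≤ x y) (*-mono 0≤‖ x ‖ 0≤‖ y ‖ x≤p y≤q)

    ‖x+y‖≤p+q : ∀ {x y p q} → ‖ x ‖ ≤ p → ‖ y ‖ ≤ q → ‖ x R.+ y ‖ ≤ p + q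
    ‖x+y‖≤p+q {x} {y} x≤p y≤q = ℚ.≤-trans (‖x+y‖≤ x y) (ℚ.+-mono-≤ x≤p y≤q)

    ‖1+x‖≤ : ∀ {x p} → ‖ x ‖ ≤ p → ‖ ι 1ℚ R.+ x ‖ ≤ 1ℚ + p
    ‖1+x‖≤ = ‖x+y‖≤p+q (ℚ.≤-reflexive (‖p‖≡p 0≤1))

    ‖‖-≤ : ∀ {x y b} → x ≈ y → ‖ y ‖ ≤ b → ‖ x ‖ ≤ b
    ‖‖-≤ {b = b} x≈y = subst (_≤ b) (sym (‖‖-cong x≈y))

    0≤b : ∀ {x b} → ‖ x ‖ ≤ b → 0ℚ ≤ b
    0≤b {x} = ℚ.≤-trans 0≤‖ x ‖

  ‖x^n‖≤ : ∀ {x M} n → ‖ x ‖ ≤ M → ‖ x ^ n ‖ ≤ M ^ℚ n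
  ‖x^n‖≤ zero    _   = ‖‖-≤ (R.sym 1-homo) (ℚ.≤-reflexive (‖p‖≡p 0≤1))
  ‖x^n‖≤ (suc n) x≤M = ‖x*y‖≤pq x≤M (‖x^n‖≤ n x≤M)

  ‖-x‖≡ : ∀ x → ‖ R.- x ‖ ≡ ‖ x ‖
  ‖-x‖≡ x = ℚ.≤-antisym (‖-x‖≤ x) (‖‖-≤ (S.solve 1 (λ x → x S.:= S.:- (S.:- x)) R.refl x) (‖-x‖≤ (R.- x)))
    where
    ‖-x‖≤ : ∀ x → ‖ R.- x ‖ ≤ ‖ x ‖
    ‖-x‖≤ x = begin
      ‖ R.- x ‖                    ≡⟨ ‖‖-cong (S.solve 1 (λ x → S.:- x S.:= S.con (- 1ℚ) S.:* x) R.refl x) ⟩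
      ‖ ι (- 1ℚ) R.* x ‖           ≤⟨ ‖x*y‖≤ (ι (- 1ℚ)) x ⟩
      ‖ ι (- 1ℚ) ‖ * ‖ x ‖         ≡⟨ cong (_* ‖ x ‖) (‖p‖≡∣p∣ (- 1ℚ)) ⟩
      1ℚ * ‖ x ‖                   ≡⟨ ℚ.*-identityˡ ‖ x ‖ ⟩
      ‖ x ‖                        ∎
      where open ℚ.≤-Reasoning

  dist-sym : ∀ x y → dist x y ≡ dist y x
  dist-sym x y = trans (sym (‖-x‖≡ (x R.- y)))
    (‖‖-cong (S.solve 2 (λ x y → S.:- (x S.:- y) S.:= y S.:- x) R.refl x y))

  dist-triangle : ∀ x y z → dist x z ≤ dist x y + dist y z
  dist-triangle x y z = ‖‖-≤ (S.solve 3 (λ x y z → x S.:- z S.:= (x S.:- y) S.:+ (y S.:- z)) R.refl x y z)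
    (‖x+y‖≤ (x R.- y) (y R.- z))

  pow-diff : ∀ {x y M Δ} n → 1ℚ ≤ M → ‖ x ‖ ≤ M → ‖ y ‖ ≤ M → dist x y ≤ Δ →
             dist (x ^ n) (y ^ n) ≤ fromℕ n * Δ * M ^ℚ n
  pow-diff {Δ = Δ} zero _ _ _ _ = ‖‖-≤ (S.solve 1 (λ x → x S.:- x S.:= S.con 0ℚ) R.refl R.1#)
    (ℚ.≤-reflexive (trans (‖p‖≡p ℚ.≤-refl) (solve 1 (λ d → con 0ℚ := con 0ℚ :* d :* con 1ℚ) refl Δ)))
  pow-diff {x} {y} {M} {Δ} (suc n) 1≤M x≤M y≤M d≤Δ = ‖‖-≤
    (S.solve 4 (λ x y p q → x S.:* p S.:- y S.:* q S.:= x S.:* (p S.:- q) S.:+ (x S.:- y) S.:* q) R.refl x y (x ^ n) (y ^ n))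
    (begin
      ‖ x R.* (x ^ n R.- y ^ n) R.+ (x R.- y) R.* y ^ n ‖
        ≤⟨ ‖x+y‖≤p+q (‖x*y‖≤pq x≤M (pow-diff n 1≤M x≤M y≤M d≤Δ)) (‖x*y‖≤pq d≤Δ (‖x^n‖≤ n y≤M)) ⟩
      M * (fromℕ n * Δ * M ^ℚ n) + Δ * M ^ℚ n
        ≤⟨ ℚ.+-monoʳ-≤ (M * (fromℕ n * Δ * M ^ℚ n)) (ℚ.*-monoˡ-≤-nonNeg Δ {{ℚ.nonNegative (0≤b d≤Δ)}} (^-≤-suc n 1≤M)) ⟩
      M * (fromℕ n * Δ * M ^ℚ n) + Δ * (M * M ^ℚ n)
        ≡⟨ solve 4 (λ M N d P → M :* (N :* d :* P) :+ d :* (M :* P) := (con 1ℚ :+ N) :* d :* (M :* P)) refl M (fromℕ n) Δ (M ^ℚ n) ⟩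
      (1ℚ + fromℕ n) * Δ * (M * M ^ℚ n)
        ≡⟨ cong (λ k → k * Δ * (M * M ^ℚ n)) (fromℕ-+ 1 n) ⟨
      fromℕ (suc n) * Δ * (M * M ^ℚ n) ∎)
    where open ℚ.≤-Reasoning

  second-order : ∀ {w ω} m → ‖ w ‖ ≤ ω →
    dist ((ι 1ℚ R.+ w) ^ m) (ι 1ℚ R.+ ι (fromℕ m) R.* w) ≤ fromℕ m * ω * (fromℕ m * ω) * (1ℚ + ω) ^ℚ m
  second-order {w} {ω} zero _ = ‖‖-≤
    (R.trans (R.+-congʳ (R.sym 1-homo)) (S.solve 1 (λ w → S.con 1ℚ S.:- (S.con 1ℚ S.:+ S.con 0ℚ S.:* w) S.:= S.con 0ℚ) R.refl w))
    (ℚ.≤-reflexive (trans (‖p‖≡p ℚ.≤-refl)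
      (solve 1 (λ d → con 0ℚ := con 0ℚ :* d :* (con 0ℚ :* d) :* con 1ℚ) refl ω)))
  second-order {w} {ω} (suc m) w≤ω = ‖‖-≤
    (R.trans (R.+-congˡ (R.-‿cong (R.+-congˡ (R.*-congʳ ι-suc))))
      (S.solve 3 (λ w m p → (S.con 1ℚ S.:+ w) S.:* p S.:- (S.con 1ℚ S.:+ (S.con 1ℚ S.:+ m) S.:* w)
          S.:= (S.con 1ℚ S.:+ w) S.:* (p S.:- (S.con 1ℚ S.:+ m S.:* w)) S.:+ m S.:* (w S.:* w))
        R.refl w (ι M) ((ι 1ℚ R.+ w) ^ m)))
    (begin
      ‖ (ι 1ℚ R.+ w) R.* ((ι 1ℚ R.+ w) ^ m R.- (ι 1ℚ R.+ ι M R.* w)) R.+ ι M R.* (w R.* w) ‖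
        ≤⟨ ‖x+y‖≤p+q (‖x*y‖≤pq (‖1+x‖≤ w≤ω) (second-order m w≤ω)) (‖ιp*x‖≤ 0≤M (‖x*y‖≤pq w≤ω w≤ω)) ⟩
      (1ℚ + ω) * (M * ω * (M * ω) * Q) + M * (ω * ω)
        ≡⟨ cong (ℚ._+_ ((1ℚ + ω) * (M * ω * (M * ω) * Q))) (ℚ.*-identityʳ (M * (ω * ω))) ⟨
      (1ℚ + ω) * (M * ω * (M * ω) * Q) + M * (ω * ω) * 1ℚ
        ≤⟨ ℚ.+-monoʳ-≤ ((1ℚ + ω) * (M * ω * (M * ω) * Q))
             (*-mono (*-nonNeg 0≤M (p*p≥0 ω)) 0≤1
               (ℚ.*-monoʳ-≤-nonNeg (ω * ω) {{ℚ.nonNegative (p*p≥0 ω)}} M≤)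
               (1≤^ (suc m) (≤-+ˡ (0≤b w≤ω)))) ⟩
      (1ℚ + ω) * (M * ω * (M * ω) * Q) + (M + (M + 1ℚ)) * (ω * ω) * ((1ℚ + ω) * Q)
        ≡⟨ solve 3 (λ M w Q → (con 1ℚ :+ w) :* (M :* w :* (M :* w) :* Q) :+ (M :+ (M :+ con 1ℚ)) :* (w :* w) :* ((con 1ℚ :+ w) :* Q)
               := (con 1ℚ :+ M) :* w :* ((con 1ℚ :+ M) :* w) :* ((con 1ℚ :+ w) :* Q)) refl M ω Q ⟩
      (1ℚ + M) * ω * ((1ℚ + M) * ω) * ((1ℚ + ω) * Q)
        ≡⟨ cong (λ k → k * ω * (k * ω) * ((1ℚ + ω) * Q)) (fromℕ-+ 1 m) ⟨
      fromℕ (suc m) * ω * (fromℕ (suc m) * ω) * ((1ℚ + ω) * Q) ∎)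
    where
    open ℚ.≤-Reasoning
    M = fromℕ m
    Q = (1ℚ + ω) ^ℚ m
    0≤M : 0ℚ ≤ M
    0≤M = 0≤fromℕ m
    M≤ : M ≤ M + (M + 1ℚ)
    M≤ = ≤-+ˡ (+-nonNeg 0≤M 0≤1)
    ι-suc : ι (fromℕ (suc m)) ≈ ι 1ℚ R.+ ι M
    ι-suc = R.trans (R.reflexive (cong ι (fromℕ-+ 1 m))) (+-homo 1ℚ M)

  module _ (b : ℕ) where
    private
      B = fromℕ b
      ‖1+z/n‖≤ : ∀ {z} n → ‖ z ‖ ≤ B → ‖ ι 1ℚ R.+ ι (1/1+ n) R.* z ‖ ≤ 1ℚ + 1/1+ n * B
      ‖1+z/n‖≤ n z≤b = ‖1+x‖≤ (‖ιp*x‖≤ (0≤1/1+ n) z≤b)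
      0≤B/n : ∀ n → 0ℚ ≤ 1/1+ n * B
      0≤B/n n = *-nonNeg (0≤1/1+ n) (0≤fromℕ b)

    compound-lipschitz : ∀ {y z} n → ‖ y ‖ ≤ B → ‖ z ‖ ≤ B → dist (compound n y) (compound n z) ≤ K b * dist y z
    compound-lipschitz {y} {z} n y≤b z≤b = begin
      dist (compound n y) (compound n z)
        ≤⟨ pow-diff (suc n) (≤-+ˡ (0≤B/n n)) (‖1+z/n‖≤ n y≤b) (‖1+z/n‖≤ n z≤b) diff ⟩
      N * (e * dist y z) * M
        ≡⟨ solve 4 (λ N e d M → N :* (e :* d) :* M := (N :* e) :* (M :* d)) refl N e (dist y z) M ⟩
      (N * e) * (M * dist y z)
        ≡⟨ cong (_* (M * dist y z)) ([1+n]/[1+n] n) ⟩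
      1ℚ * (M * dist y z)
        ≡⟨ ℚ.*-identityˡ (M * dist y z) ⟩
      M * dist y z
        ≤⟨ ℚ.*-monoʳ-≤-nonNeg (dist y z) {{ℚ.nonNegative 0≤‖ y R.- z ‖}} ([1+b/n]^n≤K b n) ⟩
      K b * dist y z ∎
      where
      open ℚ.≤-Reasoning
      N = fromℕ (suc n)
      e = 1/1+ n
      M = (1ℚ + e * B) ^ℚ suc n
      diff : dist (ι 1ℚ R.+ ι e R.* y) (ι 1ℚ R.+ ι e R.* z) ≤ e * dist y z
      diff = ‖‖-≤ (S.solve 3 (λ e y z → (S.con 1ℚ S.:+ e S.:* y) S.:- (S.con 1ℚ S.:+ e S.:* z) S.:= e S.:* (y S.:- z)) R.refl (ι e) y z)
        (‖ιp*x‖≤ (0≤1/1+ n) ℚ.≤-refl)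

    C : ℚ
    C = B * B * (K b * K b)

    private
      1≤K : 1ℚ ≤ K b
      1≤K = 1≤^ (2 ℕ.* b) (fromℕ-mono {1} {2} (ℕ.s≤s ℕ.z≤n))

      refine : ∀ {z} m n → ‖ z ‖ ≤ B →
               dist (compound (m ℕ.+ n ℕ.* suc m) z) (compound n z) ≤ C * 1/1+ n
      refine {z} m n z≤b = begin
        dist (compound (m ℕ.+ n ℕ.* suc m) z) (compound n z)
          ≡⟨ ‖‖-cong (R.+-cong split (R.-‿cong (^-congˡ (suc n) Y≈))) ⟩
        dist (X ^ suc n) (Y ^ suc n)
          ≤⟨ pow-diff (suc n) 1≤Q (‖x^n‖≤ (suc m) (‖1+x‖≤ w≤ω)) Y≤Q (second-order (suc m) w≤ω) ⟩
        N * (M * ω * (M * ω) * Q) * Q ^ℚ suc n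
          ≤⟨ *-mono (*-nonNeg (0≤fromℕ (suc n)) (*-nonNeg (p*p≥0 (M * ω)) 0≤Q)) (^-nonNeg (suc n) 0≤Q)
               (ℚ.*-monoˡ-≤-nonNeg N {{ℚ.nonNegative (0≤fromℕ (suc n))}}
                 (ℚ.*-monoˡ-≤-nonNeg (M * ω * (M * ω)) {{ℚ.nonNegative (p*p≥0 (M * ω))}} (ℚ.≤-trans (p≤p^suc n 1≤Q) Q^N≤K)))
               Q^N≤K ⟩
        N * (M * ω * (M * ω) * K b) * K b
          ≡⟨ cong (λ t → N * (t * t * K b) * K b) Mω ⟩
        N * (e * B * (e * B) * K b) * K b
          ≡⟨ solve 4 (λ N e B k → N :* (e :* B :* (e :* B) :* k) :* k := (N :* e) :* (B :* B :* (k :* k) :* e)) refl N e B (K b) ⟩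
        (N * e) * (C * e)
          ≡⟨ cong (_* (C * e)) ([1+n]/[1+n] n) ⟩
        1ℚ * (C * e)
          ≡⟨ ℚ.*-identityˡ (C * e) ⟩
        C * e ∎
        where
        open ℚ.≤-Reasoning
        N = fromℕ (suc n)
        M = fromℕ (suc m)
        e = 1/1+ n
        p = m ℕ.+ n ℕ.* suc m
        w = ι (1/1+ p) R.* z
        ω = 1/1+ p * B
        Q = (1ℚ + ω) ^ℚ suc m
        X = (ι 1ℚ R.+ w) ^ suc m
        Y = ι 1ℚ R.+ ι M R.* w
        w≤ω : ‖ w ‖ ≤ ω
        w≤ω = ‖ιp*x‖≤ (0≤1/1+ p) z≤b
        1≤Q : 1ℚ ≤ Q
        1≤Q = 1≤^ (suc m) (≤-+ˡ (0≤B/n p))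
        0≤Q : 0ℚ ≤ Q
        0≤Q = ℚ.≤-trans 0≤1 1≤Q
        M/p : M * 1/1+ p ≡ e
        M/p = trans (cong (M *_) (sym (1/1+-* n m)))
          (trans (solve 3 (λ M e f → M :* (e :* f) := (M :* f) :* e) refl M e (1/1+ m))
          (trans (cong (_* e) ([1+n]/[1+n] m)) (ℚ.*-identityˡ e)))
        Mω : M * ω ≡ e * B
        Mω = trans (sym (ℚ.*-assoc M (1/1+ p) B)) (cong (_* B) M/p)
        Y≤Q : ‖ Y ‖ ≤ Q
        Y≤Q = ℚ.≤-trans (‖1+x‖≤ (‖ιp*x‖≤ (0≤fromℕ (suc m)) w≤ω)) (bernoulli (suc m) (+-nonNeg 0≤1 (0≤B/n p)))
        Q^N≤K : Q ^ℚ suc n ≤ K b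
        Q^N≤K = ℚ.≤-trans (ℚ.≤-reflexive (trans (^ℚ-assocʳ (1ℚ + ω) (suc m) (suc n))
                  (cong ((1ℚ + ω) ^ℚ_) (ℕ.*-comm (suc m) (suc n))))) ([1+b/n]^n≤K b p)
        split : compound p z ≈ X ^ suc n
        split = R.sym (R.trans (^-assocʳ (ι 1ℚ R.+ w) (suc m) (suc n))
                  (R.reflexive (cong ((ι 1ℚ R.+ w) ^_) (ℕ.*-comm (suc m) (suc n)))))
        Y≈ : ι 1ℚ R.+ ι e R.* z ≈ Y
        Y≈ = R.+-congˡ (R.trans (R.*-congʳ (R.trans (R.reflexive (cong ι (sym M/p))) (*-homo M (1/1+ p))))
               (R.*-assoc (ι M) (ι (1/1+ p)) z))

    compound-cauchy : ∀ {z} m n → ‖ z ‖ ≤ B → dist (compound m z) (compound n z) ≤ C * (1/1+ m + 1/1+ n)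
    compound-cauchy {z} m n z≤b = begin
      dist (compound m z) (compound n z)
        ≤⟨ dist-triangle (compound m z) (compound (m ℕ.+ n ℕ.* suc m) z) (compound n z) ⟩
      dist (compound m z) (compound (m ℕ.+ n ℕ.* suc m) z) + dist (compound (m ℕ.+ n ℕ.* suc m) z) (compound n z)
        ≤⟨ ℚ.+-mono-≤ (ℚ.≤-trans (ℚ.≤-reflexive (trans (dist-sym (compound m z) _)
             (cong (λ k → dist (compound k z) (compound m z)) (ℕ.suc-injective (ℕ.*-comm (suc n) (suc m))))))
             (refine n m z≤b)) (refine m n z≤b) ⟩
      C * 1/1+ m + C * 1/1+ n
        ≡⟨ ℚ.*-distribˡ-+ C (1/1+ m) (1/1+ n) ⟨
      C * (1/1+ m + 1/1+ n) ∎
      where open ℚ.≤-Reasoning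

    compound-+ : ∀ {y z} n → ‖ y ‖ ≤ B → ‖ z ‖ ≤ B →
                 dist (compound n (y R.+ z)) (compound n y R.* compound n z) ≤ C * 1/1+ n
    compound-+ {y} {z} n y≤b z≤b = begin
      dist (compound n (y R.+ z)) (compound n y R.* compound n z)
        ≡⟨ ‖‖-cong (R.+-congˡ (R.-‿cong (R.sym (^-distrib-* _ _ (suc n))))) ⟩
      dist (X ^ suc n) (Y ^ suc n)
        ≤⟨ pow-diff (suc n) 1≤M X≤M Y≤M diff ⟩
      N * (e * e * (B * B)) * M ^ℚ suc n
        ≤⟨ ℚ.*-monoˡ-≤-nonNeg (N * (e * e * (B * B))) {{ℚ.nonNegative (*-nonNeg (0≤fromℕ (suc n)) (*-nonNeg (p*p≥0 e) (p*p≥0 B)))}} M^N≤ ⟩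
      N * (e * e * (B * B)) * (K b * K b)
        ≡⟨ solve 4 (λ N e B k → N :* (e :* e :* (B :* B)) :* (k :* k) := (N :* e) :* (B :* B :* (k :* k) :* e)) refl N e B (K b) ⟩
      (N * e) * (C * e)
        ≡⟨ cong (_* (C * e)) ([1+n]/[1+n] n) ⟩
      1ℚ * (C * e)
        ≡⟨ ℚ.*-identityˡ (C * e) ⟩
      C * e ∎
      where
      open ℚ.≤-Reasoning
      N = fromℕ (suc n)
      e = 1/1+ n
      M = (1ℚ + e * B) * (1ℚ + e * B)
      X = ι 1ℚ R.+ ι e R.* (y R.+ z)
      Y = (ι 1ℚ R.+ ι e R.* y) R.* (ι 1ℚ R.+ ι e R.* z)
      1+eB : 0ℚ ≤ 1ℚ + e * B
      1+eB = +-nonNeg 0≤1 (0≤B/n n)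
      X≤ : 1ℚ + e * (B + B) ≤ M
      X≤ = ℚ.≤-trans (≤-+ˡ (p*p≥0 (e * B))) (ℚ.≤-reflexive
             (solve 2 (λ e B → con 1ℚ :+ e :* (B :+ B) :+ e :* B :* (e :* B) := (con 1ℚ :+ e :* B) :* (con 1ℚ :+ e :* B)) refl e B))
      X≤M : ‖ X ‖ ≤ M
      X≤M = ℚ.≤-trans (‖1+x‖≤ (‖ιp*x‖≤ (0≤1/1+ n) (‖x+y‖≤p+q y≤b z≤b))) X≤
      Y≤M : ‖ Y ‖ ≤ M
      Y≤M = ‖x*y‖≤pq (‖1+z/n‖≤ n y≤b) (‖1+z/n‖≤ n z≤b)
      1≤M : 1ℚ ≤ M
      1≤M = ℚ.≤-trans (≤-+ˡ (*-nonNeg (0≤1/1+ n) (+-nonNeg (0≤fromℕ b) (0≤fromℕ b)))) X≤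
      M^N≤ : M ^ℚ suc n ≤ K b * K b
      M^N≤ = ℚ.≤-trans (ℚ.≤-reflexive (^ℚ-distrib-* (1ℚ + e * B) (1ℚ + e * B) (suc n)))
        (*-mono (^-nonNeg (suc n) 1+eB) (^-nonNeg (suc n) 1+eB) ([1+b/n]^n≤K b n) ([1+b/n]^n≤K b n))
      diff : dist X Y ≤ e * e * (B * B)
      diff = ‖‖-≤ (R.trans (S.solve 3 (λ e y z → (S.con 1ℚ S.:+ e S.:* (y S.:+ z)) S.:- (S.con 1ℚ S.:+ e S.:* y) S.:* (S.con 1ℚ S.:+ e S.:* z)
                 S.:= S.:- ((e S.:* e) S.:* (y S.:* z))) R.refl (ι e) y z)
                 (R.-‿cong (R.*-congʳ (R.sym (*-homo e e)))))
        (ℚ.≤-trans (ℚ.≤-reflexive (‖-x‖≡ _)) (‖ιp*x‖≤ (p*p≥0 e) (‖x*y‖≤pq y≤b z≤b)))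

  Bounded : (ℕ → Carrier) → Set
  Bounded z = ∃ λ b → ∃ λ N → ∀ n → N ℕ.≤ n → ‖ z n ‖ ≤ fromℕ b

  private
    common : ∀ {y z} → Bounded y → Bounded z →
             ∃ λ b → ∃ λ N → ∀ n → N ℕ.≤ n → (‖ y n ‖ ≤ fromℕ b) × (‖ z n ‖ ≤ fromℕ b)
    common (b , N , y≤b) (c , M , z≤c) = b ℕ.⊔ c , N ℕ.⊔ M , λ n le →
      ℚ.≤-trans (y≤b n (ℕ.≤-trans (ℕ.m≤m⊔n N M) le)) (fromℕ-mono (ℕ.m≤m⊔n b c)) ,
      ℚ.≤-trans (z≤c n (ℕ.≤-trans (ℕ.m≤n⊔m N M) le)) (fromℕ-mono (ℕ.m≤n⊔m b c))

    0≤1/+1/ : ∀ ((m , n) : ℕ × ℕ) → 0ℚ ≤ 1/1+ m + 1/1+ n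
    0≤1/+1/ (m , n) = +-nonNeg (0≤1/1+ m) (0≤1/1+ n)

  small-C/ : ∀ p → Small min (λ (m , n) → p * (1/1+ m + 1/1+ n))
  small-C/ p = small-*ℚ p 0≤1/+1/ (small-+ (small-1/1+ (λ (m , n) → ℕ.m⊓n≤m m n)) (small-1/1+ (λ (m , n) → ℕ.m⊓n≤n m n)))

  diagonal-cauchy : ∀ {z} → Bounded z → Small min (λ (m , n) → dist (z m) (z n)) →
                    Small min (λ (m , n) → dist (compound m (z m)) (compound n (z n)))
  diagonal-cauchy {z} (b , N , z≤b) z-cauchy = small-dom (N , bound)
    (small-+ (small-*ℚ (K b) (λ (m , n) → 0≤‖ z m R.- z n ‖) z-cauchy) (small-C/ (C b)))
    where
    bound : ∀ ((m , n) : ℕ × ℕ) → N ℕ.≤ min (m , n) →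
            dist (compound m (z m)) (compound n (z n)) ≤ K b * dist (z m) (z n) + C b * (1/1+ m + 1/1+ n)
    bound (m , n) N≤ = ℚ.≤-trans
      (dist-triangle (compound m (z m)) (compound m (z n)) (compound n (z n)))
      (ℚ.+-mono-≤ (compound-lipschitz b m (z≤b m N≤m) (z≤b n N≤n)) (compound-cauchy b m n (z≤b n N≤n)))
      where
      N≤m = ℕ.≤-trans N≤ (ℕ.m⊓n≤m m n)
      N≤n = ℕ.≤-trans N≤ (ℕ.m⊓n≤n m n)

  diagonal-cong : ∀ {y z} → Bounded y → Bounded z → Small id (λ n → dist (y n) (z n)) →
                  Small id (λ n → dist (compound n (y n)) (compound n (z n)))
  diagonal-cong {y} {z} By Bz y≈z = helper (common By Bz)
    where
    helper : ∃ (λ b → ∃ λ N → ∀ n → N ℕ.≤ n → (‖ y n ‖ ≤ fromℕ b) × (‖ z n ‖ ≤ fromℕ b)) →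
             Small id (λ n → dist (compound n (y n)) (compound n (z n)))
    helper (b , N , le) = small-dom
      (N , λ n N≤n → compound-lipschitz b n (proj₁ (le n N≤n)) (proj₂ (le n N≤n)))
      (small-*ℚ (K b) (λ n → 0≤‖ y n R.- z n ‖) y≈z)

  diagonal-+ : ∀ {y z} → Bounded y → Bounded z →
               Small id (λ n → dist (compound n (y n R.+ z n)) (compound n (y n) R.* compound n (z n)))
  diagonal-+ {y} {z} By Bz = helper (common By Bz)
    where
    helper : ∃ (λ b → ∃ λ N → ∀ n → N ℕ.≤ n → (‖ y n ‖ ≤ fromℕ b) × (‖ z n ‖ ≤ fromℕ b)) →
             Small id (λ n → dist (compound n (y n R.+ z n)) (compound n (y n) R.* compound n (z n)))
    helper (b , N , le) = small-dom
      (N , λ n N≤n → compound-+ b n (proj₁ (le n N≤n)) (proj₂ (le n N≤n)))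
      (small-*ℚ (C b) 0≤1/1+ (small-1/1+ (λ _ → ℕ.≤-refl)))

ℚ-ring : CommutativeRing 0ℓ 0ℓ
ℚ-ring = ℚ.+-*-commutativeRing

ℚ-normed : NormedℚAlgebra
ℚ-normed = record
  { ring     = ℚ-ring
  ; morphism = record
    { ⟦_⟧ = id ; +-homo = λ _ _ → refl ; *-homo = λ _ _ → refl
    ; -‿homo = λ _ → refl ; 0-homo = refl ; 1-homo = refl }
  ; ‖_‖    = ∣_∣
  ; ‖‖-cong = cong ∣_∣
  ; 0≤‖_‖  = ℚ.0≤∣p∣
  ; ‖x+y‖≤ = ℚ.∣p+q∣≤∣p∣+∣q∣
  ; ‖x*y‖≤ = λ p q → ℚ.≤-reflexive (ℚ.∣p*q∣≡∣p∣*∣q∣ p q)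
  ; ‖p‖≡∣p∣ = λ _ → refl
  }

module Cℚ = Compound ℚ-normed

Cauchy : (ℕ → ℚ) → Set
Cauchy s = Small min (λ (m , n) → ∣ s m - s n ∣)

record ℝ : Set where
  no-eta-equality
  constructor mkℝ
  field
    seq    : ℕ → ℚ
    cauchy : Cauchy seq
open ℝ public

infix 4 _≈ʳ_ _<ʳ_

-- The relations are records so that x and y can be inferred from them.
record _≈ʳ_ (x y : ℝ) : Set where
  constructor mk≈
  field
    small : Small id (λ n → ∣ seq x n - seq y n ∣)
open _≈ʳ_ public

record _<ʳ_ (x y : ℝ) : Set where
  constructor mk<
  field
    gap : ∃ λ δ → (0ℚ < δ) × ∃ λ N → ∀ n → N ℕ.≤ n → seq x n + δ ≤ seq y n
open _<ʳ_ public

opaque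
  bounded : ∀ x → Cℚ.Bounded (seq x)
  bounded x = proj₁ (≤-fromℕ B) , N , λ n N≤n → (begin
      ∣ seq x n ∣                          ≡⟨ cong ∣_∣ (solve 2 (λ a b → a := (a :- b) :+ b) refl (seq x n) (seq x N)) ⟩
      ∣ seq x n - seq x N + seq x N ∣      ≤⟨ ℚ.∣p+q∣≤∣p∣+∣q∣ (seq x n - seq x N) (seq x N) ⟩
      ∣ seq x n - seq x N ∣ + ∣ seq x N ∣  ≤⟨ ℚ.+-monoˡ-≤ ∣ seq x N ∣ (ℚ.<⇒≤ (close (n , N) (ℕ.⊓-glb N≤n ℕ.≤-refl))) ⟩
      B                                    ≤⟨ proj₂ (≤-fromℕ B) ⟩
      fromℕ (proj₁ (≤-fromℕ B))            ∎)
    where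
    open ℚ.≤-Reasoning
    N : ℕ
    N = proj₁ (cauchy x (ℚ.positive⁻¹ 1ℚ))
    close : ∀ i → N ℕ.≤ min i → ∣ seq x (proj₁ i) - seq x (proj₂ i) ∣ < 1ℚ
    close = proj₂ (cauchy x (ℚ.positive⁻¹ 1ℚ))
    B : ℚ
    B = 1ℚ + ∣ seq x N ∣

∣a+b-c-d∣≤ : ∀ a b c d → ∣ (a + b) - (c + d) ∣ ≤ ∣ a - c ∣ + ∣ b - d ∣
∣a+b-c-d∣≤ a b c d = subst (_≤ ∣ a - c ∣ + ∣ b - d ∣)
  (cong ∣_∣ (solve 4 (λ a b c d → (a :- c) :+ (b :- d) := (a :+ b) :- (c :+ d)) refl a b c d))
  (ℚ.∣p+q∣≤∣p∣+∣q∣ (a - c) (b - d))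

∣ab-cd∣≤ : ∀ a b c d → ∣ a * b - c * d ∣ ≤ ∣ a ∣ * ∣ b - d ∣ + ∣ d ∣ * ∣ a - c ∣
∣ab-cd∣≤ a b c d = begin
  ∣ a * b - c * d ∣                        ≡⟨ cong ∣_∣ (solve 4 (λ a b c d → a :* b :- c :* d := a :* (b :- d) :+ d :* (a :- c)) refl a b c d) ⟩
  ∣ a * (b - d) + d * (a - c) ∣            ≤⟨ ℚ.∣p+q∣≤∣p∣+∣q∣ (a * (b - d)) (d * (a - c)) ⟩
  ∣ a * (b - d) ∣ + ∣ d * (a - c) ∣        ≡⟨ cong₂ _+_ (ℚ.∣p*q∣≡∣p∣*∣q∣ a (b - d)) (ℚ.∣p*q∣≡∣p∣*∣q∣ d (a - c)) ⟩
  ∣ a ∣ * ∣ b - d ∣ + ∣ d ∣ * ∣ a - c ∣    ∎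
  where open ℚ.≤-Reasoning

∣-a+b∣≡ : ∀ a b → ∣ - a - - b ∣ ≡ ∣ a - b ∣
∣-a+b∣≡ a b = trans (cong ∣_∣ (solve 2 (λ a b → :- a :- :- b := :- (a :- b)) refl a b)) (ℚ.∣-p∣≡∣p∣ (a - b))

∣a-a∣≡0 : ∀ a → ∣ a - a ∣ ≡ 0ℚ
∣a-a∣≡0 a = cong ∣_∣ (ℚ.+-inverseʳ a)

infixl 6 _+ʳ_ _-ʳ_
infixl 7 _*ʳ_
infix  8 -ʳ_

opaque
  bounded∘ : ∀ {I : Set} {h : I → ℕ} (k : I → ℕ) → (∀ i → h i ℕ.≤ k i) → ∀ x →
             ∃ λ c → ∃ λ N → ∀ i → N ℕ.≤ h i → ∣ seq x (k i) ∣ ≤ fromℕ c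
  bounded∘ k h≤k x = proj₁ (bounded x) , proj₁ (proj₂ (bounded x)) ,
    λ i N≤ → proj₂ (proj₂ (bounded x)) (k i) (ℕ.≤-trans N≤ (h≤k i))

  const-cauchy : ∀ p → Cauchy (λ _ → p)
  const-cauchy p 0<δ = 0 , λ _ _ → subst (_< _) (sym (∣a-a∣≡0 p)) 0<δ

  +-cauchy : ∀ x y → Cauchy (λ n → seq x n + seq y n)
  +-cauchy x y = small-≤ (λ (m , n) → ∣a+b-c-d∣≤ (seq x m) (seq y m) (seq x n) (seq y n))
    (small-+ (cauchy x) (cauchy y))

  neg-cauchy : ∀ x → Cauchy (λ n → - seq x n)
  neg-cauchy x = small-≤ (λ (m , n) → ℚ.≤-reflexive (∣-a+b∣≡ (seq x m) (seq x n))) (cauchy x)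

  *-cauchy : ∀ x y → Cauchy (λ n → seq x n * seq y n)
  *-cauchy x y = small-≤ (λ (m , n) → ∣ab-cd∣≤ (seq x m) (seq y m) (seq x n) (seq y n))
    (small-+
      (small-*ᵇ {h = min} {f = λ (m , n) → ∣ seq y m - seq y n ∣} {g = λ (m , n) → ∣ seq x m ∣}
        (λ (m , n) → ℚ.0≤∣p∣ (seq y m - seq y n)) (bounded∘ proj₁ (λ (m , n) → ℕ.m⊓n≤m m n) x) (cauchy y))
      (small-*ᵇ {h = min} {f = λ (m , n) → ∣ seq x m - seq x n ∣} {g = λ (m , n) → ∣ seq y n ∣}
        (λ (m , n) → ℚ.0≤∣p∣ (seq x m - seq x n)) (bounded∘ proj₂ (λ (m , n) → ℕ.m⊓n≤n m n) y) (cauchy x)))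

fromℚ : ℚ → ℝ
fromℚ p = mkℝ (λ _ → p) (const-cauchy p)

_+ʳ_ : ℝ → ℝ → ℝ
x +ʳ y = mkℝ (λ n → seq x n + seq y n) (+-cauchy x y)

-ʳ_ : ℝ → ℝ
-ʳ x = mkℝ (λ n → - seq x n) (neg-cauchy x)

_*ʳ_ : ℝ → ℝ → ℝ
x *ʳ y = mkℝ (λ n → seq x n * seq y n) (*-cauchy x y)

_-ʳ_ : ℝ → ℝ → ℝ
x -ʳ y = x +ʳ -ʳ y

0ʳ 1ʳ : ℝ
0ʳ = fromℚ 0ℚ
1ʳ = fromℚ 1ℚ

pointwise : ∀ {x y} → (∀ n → seq x n ≡ seq y n) → x ≈ʳ y
pointwise {x} {y} x≡y = mk≈ λ 0<δ → 0 , λ n _ →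
  subst (_< _) (sym (trans (cong (λ t → ∣ t - seq y n ∣) (x≡y n)) (∣a-a∣≡0 (seq y n)))) 0<δ

≈ʳ-refl : ∀ {x} → x ≈ʳ x
≈ʳ-refl = pointwise λ _ → refl

≈ʳ-sym : ∀ {x y} → x ≈ʳ y → y ≈ʳ x
≈ʳ-sym {x} {y} x≈y = mk≈ (small-≤ (λ n → ℚ.≤-reflexive (∣p-q∣≡∣q-p∣ (seq y n) (seq x n))) (small x≈y))

≈ʳ-trans : ∀ {x y z} → x ≈ʳ y → y ≈ʳ z → x ≈ʳ z
≈ʳ-trans {x} {y} {z} x≈y y≈z =
  mk≈ (small-≤ (λ n → Cℚ.dist-triangle (seq x n) (seq y n) (seq z n)) (small-+ (small x≈y) (small y≈z)))

+ʳ-cong : ∀ {x x′ y y′} → x ≈ʳ x′ → y ≈ʳ y′ → x +ʳ y ≈ʳ x′ +ʳ y′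
+ʳ-cong {x} {x′} {y} {y′} p q =
  mk≈ (small-≤ (λ n → ∣a+b-c-d∣≤ (seq x n) (seq y n) (seq x′ n) (seq y′ n)) (small-+ (small p) (small q)))

*ʳ-cong : ∀ {x x′ y y′} → x ≈ʳ x′ → y ≈ʳ y′ → x *ʳ y ≈ʳ x′ *ʳ y′
*ʳ-cong {x} {x′} {y} {y′} p q =
  mk≈ (small-≤ (λ n → ∣ab-cd∣≤ (seq x n) (seq y n) (seq x′ n) (seq y′ n))
    (small-+
      (small-*ᵇ {f = λ n → ∣ seq y n - seq y′ n ∣} {g = λ n → ∣ seq x n ∣} (λ n → ℚ.0≤∣p∣ (seq y n - seq y′ n)) (bounded∘ id (λ _ → ℕ.≤-refl) x) (small q))
      (small-*ᵇ {f = λ n → ∣ seq x n - seq x′ n ∣} {g = λ n → ∣ seq y′ n ∣} (λ n → ℚ.0≤∣p∣ (seq x n - seq x′ n)) (bounded∘ id (λ _ → ℕ.≤-refl) y′) (small p))))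

-ʳ-cong : ∀ {x y} → x ≈ʳ y → -ʳ x ≈ʳ -ʳ y
-ʳ-cong {x} {y} x≈y = mk≈ (small-≤ (λ n → ℚ.≤-reflexive (∣-a+b∣≡ (seq x n) (seq y n))) (small x≈y))

ℝ-ring : CommutativeRing 0ℓ 0ℓ
ℝ-ring = record
  { Carrier = ℝ ; _≈_ = _≈ʳ_ ; _+_ = _+ʳ_ ; _*_ = _*ʳ_ ; -_ = -ʳ_ ; 0# = 0ʳ ; 1# = 1ʳ
  ; isCommutativeRing = record
    { isRing = record
      { +-isAbelianGroup = record
        { isGroup = record
          { isMonoid = record
            { isSemigroup = record
              { isMagma = record
                { isEquivalence = record { refl = ≈ʳ-refl ; sym = ≈ʳ-sym ; trans = ≈ʳ-trans }
                ; ∙-cong = +ʳ-cong }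
              ; assoc = λ x y z → pointwise λ n → ℚ.+-assoc (seq x n) (seq y n) (seq z n) }
            ; identity = (λ x → pointwise λ n → ℚ.+-identityˡ (seq x n))
                       , (λ x → pointwise λ n → ℚ.+-identityʳ (seq x n)) }
          ; inverse = (λ x → pointwise λ n → ℚ.+-inverseˡ (seq x n))
                    , (λ x → pointwise λ n → ℚ.+-inverseʳ (seq x n))
          ; ⁻¹-cong = -ʳ-cong }
        ; comm = λ x y → pointwise λ n → ℚ.+-comm (seq x n) (seq y n) }
      ; *-cong = *ʳ-cong
      ; *-assoc = λ x y z → pointwise λ n → ℚ.*-assoc (seq x n) (seq y n) (seq z n)
      ; *-identity = (λ x → pointwise λ n → ℚ.*-identityˡ (seq x n))
                   , (λ x → pointwise λ n → ℚ.*-identityʳ (seq x n))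
      ; distrib = (λ x y z → pointwise λ n → ℚ.*-distribˡ-+ (seq x n) (seq y n) (seq z n))
                , (λ x y z → pointwise λ n → ℚ.*-distribʳ-+ (seq x n) (seq y n) (seq z n)) }
    ; *-comm = λ x y → pointwise λ n → ℚ.*-comm (seq x n) (seq y n) } }

ℚ⟶ℝ : CommutativeRing.rawRing ℚ-ring -Raw-AlmostCommutative⟶ fromCommutativeRing ℝ-ring
ℚ⟶ℝ = record
  { ⟦_⟧ = fromℚ ; +-homo = λ _ _ → pointwise λ _ → refl ; *-homo = λ _ _ → pointwise λ _ → refl
  ; -‿homo = λ _ → pointwise λ _ → refl ; 0-homo = ≈ʳ-refl ; 1-homo = ≈ʳ-refl }

module ℝ-solver = ℚ-Solver ℝ-ring ℚ⟶ℝ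


opaque
  exp-cauchy : ∀ x → Cauchy (λ n → Cℚ.compound n (seq x n))
  exp-cauchy x = Cℚ.diagonal-cauchy (bounded x) (cauchy x)

-- The exponential is lim (1 + x / n) ^ n.  The limit is taken along the rational
-- approximations of x, which is harmless because (1 + x / n) ^ n is Lipschitz in x
-- on bounded sets, uniformly in n.
exp : ℝ → ℝ
exp x = mkℝ (λ n → Cℚ.compound n (seq x n)) (exp-cauchy x)

opaque
  exp-cong : ∀ {x y} → x ≈ʳ y → exp x ≈ʳ exp y
  exp-cong {x} {y} x≈y = mk≈ (Cℚ.diagonal-cong (bounded x) (bounded y) (small x≈y))

  exp-+ : ∀ x y → exp (x +ʳ y) ≈ʳ exp x *ʳ exp y
  exp-+ x y = mk≈ (Cℚ.diagonal-+ (bounded x) (bounded y))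

  exp-0 : exp 0ʳ ≈ʳ 1ʳ
  exp-0 = pointwise λ n → trans (cong (_^ℚ suc n) (solve 1 (λ e → con 1ℚ :+ e :* con 0ℚ := con 1ℚ) refl (1/1+ n))) (1^n (suc n))


pow-expand : ∀ {x y} n → 1ℚ ≤ y → y ≤ x → fromℕ n * (x - y) ≤ x ^ℚ n - y ^ℚ n
pow-expand {x} {y} zero _ _ = ℚ.≤-reflexive (solve 2 (λ x y → con 0ℚ :* (x :- y) := con 1ℚ :- con 1ℚ) refl x y)
pow-expand {x} {y} (suc n) 1≤y y≤x = begin
  fromℕ (suc n) * d                            ≡⟨ cong (_* d) (fromℕ-+ 1 n) ⟩
  (1ℚ + fromℕ n) * d                           ≡⟨ solve 2 (λ N d → (con 1ℚ :+ N) :* d := con 1ℚ :* (N :* d) :+ d :* con 1ℚ) refl (fromℕ n) d ⟩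
  1ℚ * (fromℕ n * d) + d * 1ℚ                  ≤⟨ ℚ.+-mono-≤
      (*-mono 0≤1 (*-nonNeg (0≤fromℕ n) (0≤p-q y≤x)) (ℚ.≤-trans 1≤y y≤x) (pow-expand n 1≤y y≤x))
      (ℚ.*-monoˡ-≤-nonNeg d {{ℚ.nonNegative (0≤p-q y≤x)}} (1≤^ n 1≤y)) ⟩
  x * (x ^ℚ n - y ^ℚ n) + d * y ^ℚ n           ≡⟨ solve 4 (λ x y p q → x :* (p :- q) :+ (x :- y) :* q := x :* p :- y :* q) refl x y (x ^ℚ n) (y ^ℚ n) ⟩
  x * x ^ℚ n - y * y ^ℚ n                      ∎
  where
  open ℚ.≤-Reasoning
  d = x - y

compound-expand : ∀ {x y} n → 0ℚ ≤ y → y ≤ x → x - y ≤ Cℚ.compound n x - Cℚ.compound n y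
compound-expand {x} {y} n 0≤y y≤x = begin
  x - y                                      ≡⟨ ℚ.*-identityˡ (x - y) ⟨
  1ℚ * (x - y)                               ≡⟨ cong (_* (x - y)) ([1+n]/[1+n] n) ⟨
  fromℕ (suc n) * 1/1+ n * (x - y)           ≡⟨ solve 4 (λ N e x y → N :* e :* (x :- y) := N :* ((con 1ℚ :+ e :* x) :- (con 1ℚ :+ e :* y))) refl (fromℕ (suc n)) (1/1+ n) x y ⟩
  fromℕ (suc n) * ((1ℚ + 1/1+ n * x) - (1ℚ + 1/1+ n * y))
    ≤⟨ pow-expand (suc n) (≤-+ˡ (*-nonNeg (0≤1/1+ n) 0≤y)) (ℚ.+-monoʳ-≤ 1ℚ (ℚ.*-monoˡ-≤-nonNeg (1/1+ n) {{ℚ.nonNegative (0≤1/1+ n)}} y≤x)) ⟩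
  Cℚ.compound n x - Cℚ.compound n y          ∎
  where open ℚ.≤-Reasoning

compound-expand′ : ∀ {x y} n → 0ℚ ≤ x → 0ℚ ≤ y → ∣ x - y ∣ ≤ ∣ Cℚ.compound n x - Cℚ.compound n y ∣
compound-expand′ {x} {y} n 0≤x 0≤y with ℚ.≤-total y x
... | inj₁ y≤x = begin
  ∣ x - y ∣                                  ≡⟨ ℚ.0≤p⇒∣p∣≡p (0≤p-q y≤x) ⟩
  x - y                                      ≤⟨ compound-expand n 0≤y y≤x ⟩
  Cℚ.compound n x - Cℚ.compound n y          ≤⟨ p≤∣p∣ _ ⟩
  ∣ Cℚ.compound n x - Cℚ.compound n y ∣      ∎
  where open ℚ.≤-Reasoning
... | inj₂ x≤y = begin
  ∣ x - y ∣                                  ≡⟨ ∣p-q∣≡∣q-p∣ x y ⟩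
  ∣ y - x ∣                                  ≡⟨ ℚ.0≤p⇒∣p∣≡p (0≤p-q x≤y) ⟩
  y - x                                      ≤⟨ compound-expand n 0≤x x≤y ⟩
  Cℚ.compound n y - Cℚ.compound n x          ≤⟨ p≤∣p∣ _ ⟩
  ∣ Cℚ.compound n y - Cℚ.compound n x ∣      ≡⟨ ∣p-q∣≡∣q-p∣ (Cℚ.compound n y) (Cℚ.compound n x) ⟩
  ∣ Cℚ.compound n x - Cℚ.compound n y ∣      ∎
  where open ℚ.≤-Reasoning

1+x≤compound : ∀ {x} n → 0ℚ ≤ x → 1ℚ + x ≤ Cℚ.compound n x
1+x≤compound {x} n 0≤x = begin
  1ℚ + x                                ≡⟨ cong (1ℚ ℚ.+_) (ℚ.*-identityˡ x) ⟨
  1ℚ + 1ℚ * x                           ≡⟨ cong (λ t → 1ℚ + t * x) ([1+n]/[1+n] n) ⟨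
  1ℚ + fromℕ (suc n) * 1/1+ n * x       ≡⟨ cong (1ℚ ℚ.+_) (ℚ.*-assoc (fromℕ (suc n)) (1/1+ n) x) ⟩
  1ℚ + fromℕ (suc n) * (1/1+ n * x)     ≤⟨ bernoulli (suc n) (+-nonNeg 0≤1 (*-nonNeg (0≤1/1+ n) 0≤x)) ⟩
  Cℚ.compound n x                       ∎
  where open ℚ.≤-Reasoning

-- The largest i ≤ m with (1 + x / (n + 1)) ^ (n + 1) ≤ v at x = i / (n + 1)
grid : ℕ → ℚ → ℕ → ℕ
grid n v zero    = 0
grid n v (suc m) = if does (Cℚ.compound n (fromℕ (suc m) * 1/1+ n) ℚ.≤? v) then suc m else grid n v m

Between : ℕ → ℚ → ℕ → ℕ → Set
Between n v m i = (i ℕ.≤ m) × (Cℚ.compound n (fromℕ i * 1/1+ n) ≤ v) × (v < Cℚ.compound n (fromℕ (suc i) * 1/1+ n))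

private
  if-dec : ∀ {P : Set} (Q : ℕ → Set) {i j} (P? : Dec P) → (P → Q i) → (¬ P → Q j) → Q (if does P? then i else j)
  if-dec Q (yes p) f g = f p
  if-dec Q (no ¬p) f g = g ¬p

grid-spec : ∀ n {v} m → 1ℚ ≤ v → v < Cℚ.compound n (fromℕ (suc m) * 1/1+ n) → Between n v m (grid n v m)
grid-spec n {v} zero 1≤v v< = ℕ.z≤n , subst (_≤ v) (sym eq) 1≤v , v<
  where
  eq : Cℚ.compound n (0ℚ * 1/1+ n) ≡ 1ℚ
  eq = trans (cong (_^ℚ suc n) (solve 1 (λ e → con 1ℚ :+ e :* (con 0ℚ :* e) := con 1ℚ) refl (1/1+ n))) (1^n (suc n))
grid-spec n {v} (suc m) 1≤v v< = if-dec (Between n v (suc m)) (Cℚ.compound n (fromℕ (suc m) * 1/1+ n) ℚ.≤? v)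
  (λ le → ℕ.≤-refl , le , v<)
  (λ ≰v → let ih = grid-spec n m 1≤v (ℚ.≰⇒> ≰v) in ℕ.m≤n⇒m≤1+n (proj₁ ih) , proj₂ ih)

module Log≥1 (v : ℝ) (1≤v : ∃ λ N → ∀ n → N ℕ.≤ n → 1ℚ ≤ seq v n) where
  private
    b N : ℕ
    b = proj₁ (bounded v)
    N = proj₁ 1≤v ℕ.⊔ proj₁ (proj₂ (bounded v))

    i : ℕ → ℕ
    i n = grid n (seq v n) (b ℕ.* suc n)

    r : ℕ → ℚ
    r n = fromℕ (i n) * 1/1+ n

    L : ℕ → ℚ → ℚ
    L = Cℚ.compound

    0≤r : ∀ n → 0ℚ ≤ r n
    0≤r n = *-nonNeg (0≤fromℕ (i n)) (0≤1/1+ n)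

    spec : ∀ n → N ℕ.≤ n → (i n ℕ.≤ b ℕ.* suc n) × (L n (r n) ≤ seq v n) × (seq v n < L n (fromℕ (suc (i n)) * 1/1+ n))
    spec n N≤n = grid-spec n (b ℕ.* suc n) (proj₂ 1≤v n (ℕ.≤-trans (ℕ.m≤m⊔n _ _) N≤n)) (begin-strict
      seq v n                                   ≤⟨ p≤∣p∣ (seq v n) ⟩
      ∣ seq v n ∣                               ≤⟨ proj₂ (proj₂ (bounded v)) n (ℕ.≤-trans (ℕ.m≤n⊔m (proj₁ 1≤v) _) N≤n) ⟩
      fromℕ b                                   ≡⟨ ℚ.+-identityˡ (fromℕ b) ⟨
      0ℚ + fromℕ b                              <⟨ ℚ.+-monoˡ-< (fromℕ b) (ℚ.positive⁻¹ 1ℚ) ⟩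
      1ℚ + fromℕ b                              ≤⟨ ℚ.+-monoʳ-≤ 1ℚ (≤-+ˡ {fromℕ b} (0≤1/1+ n)) ⟩
      1ℚ + (fromℕ b + 1/1+ n)                   ≡⟨ cong (1ℚ ℚ.+_) top ⟨
      1ℚ + fromℕ (suc (b ℕ.* suc n)) * 1/1+ n   ≤⟨ 1+x≤compound n (*-nonNeg (0≤fromℕ (suc (b ℕ.* suc n))) (0≤1/1+ n)) ⟩
      L n (fromℕ (suc (b ℕ.* suc n)) * 1/1+ n)  ∎)
      where
      open ℚ.≤-Reasoning
      top : fromℕ (suc (b ℕ.* suc n)) * 1/1+ n ≡ fromℕ b + 1/1+ n
      top = trans (cong (_* 1/1+ n) (trans (fromℕ-+ 1 (b ℕ.* suc n)) (cong (1ℚ ℚ.+_) (fromℕ-* b (suc n)))))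
        (trans (solve 3 (λ b N e → (con 1ℚ :+ b :* N) :* e := b :* (N :* e) :+ e) refl (fromℕ b) (fromℕ (suc n)) (1/1+ n))
          (cong (_+ 1/1+ n) (trans (cong (fromℕ b *_) ([1+n]/[1+n] n)) (ℚ.*-identityʳ (fromℕ b)))))

    r≤b : ∀ n → N ℕ.≤ n → r n ≤ fromℕ b
    r≤b n N≤n = begin
      fromℕ (i n) * 1/1+ n                   ≤⟨ ℚ.*-monoʳ-≤-nonNeg (1/1+ n) {{ℚ.nonNegative (0≤1/1+ n)}} (fromℕ-mono (proj₁ (spec n N≤n))) ⟩
      fromℕ (b ℕ.* suc n) * 1/1+ n           ≡⟨ cong (_* 1/1+ n) (fromℕ-* b (suc n)) ⟩
      fromℕ b * fromℕ (suc n) * 1/1+ n       ≡⟨ ℚ.*-assoc (fromℕ b) (fromℕ (suc n)) (1/1+ n) ⟩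
      fromℕ b * (fromℕ (suc n) * 1/1+ n)     ≡⟨ cong (fromℕ b *_) ([1+n]/[1+n] n) ⟩
      fromℕ b * 1ℚ                           ≡⟨ ℚ.*-identityʳ (fromℕ b) ⟩
      fromℕ b                                ∎
      where open ℚ.≤-Reasoning

    next : ∀ n → fromℕ (suc (i n)) * 1/1+ n ≡ r n + 1/1+ n
    next n = trans (cong (_* 1/1+ n) (fromℕ-+ 1 (i n)))
      (solve 2 (λ i e → (con 1ℚ :+ i) :* e := i :* e :+ e) refl (fromℕ (i n)) (1/1+ n))

    close : ∀ n → N ℕ.≤ n → ∣ L n (r n) - seq v n ∣ ≤ K (suc b) * 1/1+ n
    close n N≤n = begin
      ∣ L n (r n) - seq v n ∣                  ≡⟨ ∣p-q∣≡∣q-p∣ (L n (r n)) (seq v n) ⟩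
      ∣ seq v n - L n (r n) ∣                  ≡⟨ ℚ.0≤p⇒∣p∣≡p (0≤p-q (proj₁ (proj₂ (spec n N≤n)))) ⟩
      seq v n - L n (r n)                      ≤⟨ ℚ.+-monoˡ-≤ (- L n (r n)) (ℚ.<⇒≤ (proj₂ (proj₂ (spec n N≤n)))) ⟩
      L n (fromℕ (suc (i n)) * 1/1+ n) - L n (r n)  ≡⟨ cong (λ t → L n t - L n (r n)) (next n) ⟩
      L n (r n + 1/1+ n) - L n (r n)           ≤⟨ p≤∣p∣ _ ⟩
      ∣ L n (r n + 1/1+ n) - L n (r n) ∣       ≤⟨ Cℚ.compound-lipschitz (suc b) n r′≤ r≤ ⟩
      K (suc b) * ∣ r n + 1/1+ n - r n ∣       ≡⟨ cong (K (suc b) *_) (trans (cong ∣_∣ (solve 2 (λ r e → r :+ e :- r := e) refl (r n) (1/1+ n))) (ℚ.0≤p⇒∣p∣≡p (0≤1/1+ n))) ⟩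
      K (suc b) * 1/1+ n                       ∎
      where
      open ℚ.≤-Reasoning
      r′≤ : ∣ r n + 1/1+ n ∣ ≤ fromℕ (suc b)
      r′≤ = ℚ.≤-trans (ℚ.≤-reflexive (ℚ.0≤p⇒∣p∣≡p (+-nonNeg (0≤r n) (0≤1/1+ n))))
        (ℚ.≤-trans (ℚ.+-mono-≤ (r≤b n N≤n) (1/1+-anti {0} {n} ℕ.z≤n))
          (ℚ.≤-reflexive (trans (ℚ.+-comm (fromℕ b) 1ℚ) (sym (fromℕ-+ 1 b)))))
      r≤ : ∣ r n ∣ ≤ fromℕ (suc b)
      r≤ = ℚ.≤-trans (ℚ.≤-reflexive (ℚ.0≤p⇒∣p∣≡p (0≤r n)))
        (ℚ.≤-trans (r≤b n N≤n) (fromℕ-mono (ℕ.n≤1+n b)))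

    C′ : ℚ
    C′ = Cℚ.C (suc b)

    r-gap : ∀ ((m , n) : ℕ × ℕ) → N ℕ.≤ m ℕ.⊓ n →
          ∣ r m - r n ∣ ≤ ∣ seq v m - seq v n ∣ + (K (suc b) * (1/1+ m + 1/1+ n) + C′ * (1/1+ m + 1/1+ n))
    r-gap (m , n) N≤ = begin
      ∣ r m - r n ∣
        ≤⟨ compound-expand′ m (0≤r m) (0≤r n) ⟩
      ∣ L m (r m) - L m (r n) ∣
        ≤⟨ Cℚ.dist-triangle (L m (r m)) (seq v m) (L m (r n)) ⟩
      ∣ L m (r m) - seq v m ∣ + ∣ seq v m - L m (r n) ∣
        ≤⟨ ℚ.+-mono-≤ (close m N≤m) (Cℚ.dist-triangle (seq v m) (seq v n) (L m (r n))) ⟩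
      K (suc b) * 1/1+ m + (∣ seq v m - seq v n ∣ + ∣ seq v n - L m (r n) ∣)
        ≤⟨ ℚ.+-monoʳ-≤ (K (suc b) * 1/1+ m) (ℚ.+-monoʳ-≤ ∣ seq v m - seq v n ∣
             (ℚ.≤-trans (Cℚ.dist-triangle (seq v n) (L n (r n)) (L m (r n)))
               (ℚ.+-mono-≤ (ℚ.≤-trans (ℚ.≤-reflexive (∣p-q∣≡∣q-p∣ (seq v n) (L n (r n)))) (close n N≤n))
                 (ℚ.≤-trans (ℚ.≤-reflexive (∣p-q∣≡∣q-p∣ (L n (r n)) (L m (r n))))
                    (Cℚ.compound-cauchy (suc b) m n r≤))))) ⟩
      K (suc b) * 1/1+ m + (∣ seq v m - seq v n ∣ + (K (suc b) * 1/1+ n + C′ * (1/1+ m + 1/1+ n)))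
        ≡⟨ solve 5 (λ k e f d c → k :* e :+ (d :+ (k :* f :+ c :* (e :+ f))) := d :+ (k :* (e :+ f) :+ c :* (e :+ f))) refl
             (K (suc b)) (1/1+ m) (1/1+ n) ∣ seq v m - seq v n ∣ C′ ⟩
      ∣ seq v m - seq v n ∣ + (K (suc b) * (1/1+ m + 1/1+ n) + C′ * (1/1+ m + 1/1+ n)) ∎
      where
      open ℚ.≤-Reasoning
      N≤m = ℕ.≤-trans N≤ (ℕ.m⊓n≤m m n)
      N≤n = ℕ.≤-trans N≤ (ℕ.m⊓n≤n m n)
      r≤ : ∣ r n ∣ ≤ fromℕ (suc b)
      r≤ = ℚ.≤-trans (ℚ.≤-reflexive (ℚ.0≤p⇒∣p∣≡p (0≤r n)))
        (ℚ.≤-trans (r≤b n N≤n) (fromℕ-mono (ℕ.n≤1+n b)))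

    opaque
      r-cauchy : Cauchy r
      r-cauchy = small-dom (N , r-gap) (small-+ (cauchy v) (small-+ (Cℚ.small-C/ (K (suc b))) (Cℚ.small-C/ C′)))

  log : ℝ
  log = mkℝ r r-cauchy

  opaque
    exp-log : exp log ≈ʳ v
    exp-log = mk≈ (small-dom (N , close) (small-*ℚ (K (suc b)) 0≤1/1+ (small-1/1+ (λ _ → ℕ.≤-refl))))


-- With c so large that a e^c ≥ 1, ln a = ln (a e^c) - c.
module Ln (a : ℝ) (0<a : 0ʳ <ʳ a) where
  private
    δ = proj₁ (gap 0<a)
    0<δ = proj₁ (proj₂ (gap 0<a))
    N = proj₁ (proj₂ (proj₂ (gap 0<a)))
    δ≤a = proj₂ (proj₂ (proj₂ (gap 0<a)))

    c : ℝ
    c = fromℚ (fromℕ (proj₁ (archimedean 0<δ)))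

    1≤aeᶜ : ∃ λ N → ∀ n → N ℕ.≤ n → 1ℚ ≤ seq (a *ʳ exp c) n
    1≤aeᶜ = N , λ n N≤n → (begin
      1ℚ                          ≡⟨ 1/-inverse 1 (suc k) ⟨
      1/1+ k * fromℕ (suc k)      ≤⟨ *-mono (0≤1/1+ k) (0≤fromℕ (suc k))
                                       (ℚ.≤-trans (ℚ.<⇒≤ (proj₂ (archimedean 0<δ))) (subst (_≤ seq a n) (ℚ.+-identityˡ δ) (δ≤a n N≤n)))
                                       (ℚ.≤-trans (ℚ.≤-reflexive (fromℕ-+ 1 k)) (1+x≤compound n (0≤fromℕ k))) ⟩
      seq a n * seq (exp c) n     ∎)
      where
      open ℚ.≤-Reasoning
      k = proj₁ (archimedean 0<δ)

    module L = Log≥1 (a *ʳ exp c) 1≤aeᶜ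

  ln : ℝ
  ln = L.log -ʳ c

  exp-ln : exp ln ≈ʳ a
  exp-ln = begin
    exp (L.log -ʳ c)                   ≈⟨ exp-+ L.log (-ʳ c) ⟩
    exp L.log *ʳ exp (-ʳ c)            ≈⟨ *ʳ-cong L.exp-log ≈ʳ-refl ⟩
    a *ʳ exp c *ʳ exp (-ʳ c)           ≈⟨ R.*-assoc a (exp c) (exp (-ʳ c)) ⟩
    a *ʳ (exp c *ʳ exp (-ʳ c))         ≈⟨ *ʳ-cong ≈ʳ-refl (exp-+ c (-ʳ c)) ⟨
    a *ʳ exp (c -ʳ c)                  ≈⟨ *ʳ-cong ≈ʳ-refl (≈ʳ-trans (exp-cong (R.-‿inverseʳ c)) exp-0) ⟩
    a *ʳ 1ʳ                            ≈⟨ R.*-identityʳ a ⟩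
    a                                  ∎
    where
    module R = CommutativeRing ℝ-ring
    open Relation.Binary.Reasoning.Setoid R.setoid

open Ln public using (ln; exp-ln)

record ℚ[i] : Set where
  constructor _+i_
  field re im : ℚ
open ℚ[i] using (re; im)

infixl 6 _+ⁱ_
infixl 7 _*ⁱ_

_+ⁱ_ _*ⁱ_ : ℚ[i] → ℚ[i] → ℚ[i]
x +ⁱ y = (re x + re y) +i (im x + im y)
x *ⁱ y = (re x * re y - im x * im y) +i (re x * im y + im x * re y)

-ⁱ_ : ℚ[i] → ℚ[i]
-ⁱ x = (- re x) +i (- im x)

ℚ[i]-ring : CommutativeRing 0ℓ 0ℓ
ℚ[i]-ring = record
  { Carrier = ℚ[i] ; _≈_ = _≡_ ; _+_ = _+ⁱ_ ; _*_ = _*ⁱ_ ; -_ = -ⁱ_ ; 0# = 0ℚ +i 0ℚ ; 1# = 1ℚ +i 0ℚ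
  ; isCommutativeRing = record
    { isRing = record
      { +-isAbelianGroup = record
        { isGroup = record
          { isMonoid = record
            { isSemigroup = record
              { isMagma = record
                { isEquivalence = record { refl = refl ; sym = sym ; trans = trans }
                ; ∙-cong = cong₂ _+ⁱ_ }
              ; assoc = λ x y z → cong₂ _+i_ (ℚ.+-assoc (re x) (re y) (re z)) (ℚ.+-assoc (im x) (im y) (im z)) }
            ; identity = (λ x → cong₂ _+i_ (ℚ.+-identityˡ (re x)) (ℚ.+-identityˡ (im x)))
                       , (λ x → cong₂ _+i_ (ℚ.+-identityʳ (re x)) (ℚ.+-identityʳ (im x))) }
          ; inverse = (λ x → cong₂ _+i_ (ℚ.+-inverseˡ (re x)) (ℚ.+-inverseˡ (im x)))
                    , (λ x → cong₂ _+i_ (ℚ.+-inverseʳ (re x)) (ℚ.+-inverseʳ (im x)))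
          ; ⁻¹-cong = cong -ⁱ_ }
        ; comm = λ x y → cong₂ _+i_ (ℚ.+-comm (re x) (re y)) (ℚ.+-comm (im x) (im y)) }
      ; *-cong = cong₂ _*ⁱ_
      ; *-assoc = λ x y z → cong₂ _+i_
          (solve 6 (λ a b c d e f → (a :* c :- b :* d) :* e :- (a :* d :+ b :* c) :* f
             := a :* (c :* e :- d :* f) :- b :* (c :* f :+ d :* e)) refl (re x) (im x) (re y) (im y) (re z) (im z))
          (solve 6 (λ a b c d e f → (a :* c :- b :* d) :* f :+ (a :* d :+ b :* c) :* e
             := a :* (c :* f :+ d :* e) :+ b :* (c :* e :- d :* f)) refl (re x) (im x) (re y) (im y) (re z) (im z))
      ; *-identity = (λ x → cong₂ _+i_
          (solve 2 (λ a b → con 1ℚ :* a :- con 0ℚ :* b := a) refl (re x) (im x))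
          (solve 2 (λ a b → con 1ℚ :* b :+ con 0ℚ :* a := b) refl (re x) (im x)))
        , (λ x → cong₂ _+i_
          (solve 2 (λ a b → a :* con 1ℚ :- b :* con 0ℚ := a) refl (re x) (im x))
          (solve 2 (λ a b → a :* con 0ℚ :+ b :* con 1ℚ := b) refl (re x) (im x)))
      ; distrib = (λ x y z → cong₂ _+i_
          (solve 6 (λ a b c d e f → a :* (c :+ e) :- b :* (d :+ f) := (a :* c :- b :* d) :+ (a :* e :- b :* f))
            refl (re x) (im x) (re y) (im y) (re z) (im z))
          (solve 6 (λ a b c d e f → a :* (d :+ f) :+ b :* (c :+ e) := (a :* d :+ b :* c) :+ (a :* f :+ b :* e))
            refl (re x) (im x) (re y) (im y) (re z) (im z)))
        , (λ x y z → cong₂ _+i_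
          (solve 6 (λ a b c d e f → (c :+ e) :* a :- (d :+ f) :* b := (c :* a :- d :* b) :+ (e :* a :- f :* b))
            refl (re x) (im x) (re y) (im y) (re z) (im z))
          (solve 6 (λ a b c d e f → (c :+ e) :* b :+ (d :+ f) :* a := (c :* b :+ d :* a) :+ (e :* b :+ f :* a))
            refl (re x) (im x) (re y) (im y) (re z) (im z))) }
    ; *-comm = λ x y → cong₂ _+i_
        (solve 4 (λ a b c d → a :* c :- b :* d := c :* a :- d :* b) refl (re x) (im x) (re y) (im y))
        (solve 4 (λ a b c d → a :* d :+ b :* c := c :* b :+ d :* a) refl (re x) (im x) (re y) (im y)) } }

∣_∣₁ : ℚ[i] → ℚ
∣ x ∣₁ = ∣ re x ∣ + ∣ im x ∣

opaque
  ∣re∣≤ : ∀ x → ∣ re x ∣ ≤ ∣ x ∣₁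
  ∣re∣≤ x = ≤-+ˡ (ℚ.0≤∣p∣ (im x))

  ∣im∣≤ : ∀ x → ∣ im x ∣ ≤ ∣ x ∣₁
  ∣im∣≤ x = ≤-+ʳ (ℚ.0≤∣p∣ (re x))

  ∣x+y∣₁≤ : ∀ x y → ∣ x +ⁱ y ∣₁ ≤ ∣ x ∣₁ + ∣ y ∣₁
  ∣x+y∣₁≤ x y = ℚ.≤-trans (ℚ.+-mono-≤ (ℚ.∣p+q∣≤∣p∣+∣q∣ (re x) (re y)) (ℚ.∣p+q∣≤∣p∣+∣q∣ (im x) (im y)))
    (ℚ.≤-reflexive (solve 4 (λ a b c d → (a :+ b) :+ (c :+ d) := (a :+ c) :+ (b :+ d)) refl
      (∣ re x ∣) (∣ re y ∣) (∣ im x ∣) (∣ im y ∣)))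

  ∣x*y∣₁≤ : ∀ x y → ∣ x *ⁱ y ∣₁ ≤ ∣ x ∣₁ * ∣ y ∣₁
  ∣x*y∣₁≤ (a +i b) (c +i d) = begin
    ∣ a * c - b * d ∣ + ∣ a * d + b * c ∣
      ≤⟨ ℚ.+-mono-≤ (ℚ.∣p-q∣≤∣p∣+∣q∣ (a * c) (b * d)) (ℚ.∣p+q∣≤∣p∣+∣q∣ (a * d) (b * c)) ⟩
    (∣ a * c ∣ + ∣ b * d ∣) + (∣ a * d ∣ + ∣ b * c ∣)
      ≡⟨ cong₂ _+_ (cong₂ _+_ (ℚ.∣p*q∣≡∣p∣*∣q∣ a c) (ℚ.∣p*q∣≡∣p∣*∣q∣ b d))
                   (cong₂ _+_ (ℚ.∣p*q∣≡∣p∣*∣q∣ a d) (ℚ.∣p*q∣≡∣p∣*∣q∣ b c)) ⟩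
    (∣ a ∣ * ∣ c ∣ + ∣ b ∣ * ∣ d ∣) + (∣ a ∣ * ∣ d ∣ + ∣ b ∣ * ∣ c ∣)
      ≡⟨ solve 4 (λ a b c d → (a :* c :+ b :* d) :+ (a :* d :+ b :* c) := (a :+ b) :* (c :+ d)) refl (∣ a ∣) (∣ b ∣) (∣ c ∣) (∣ d ∣) ⟩
    (∣ a ∣ + ∣ b ∣) * (∣ c ∣ + ∣ d ∣) ∎
    where open ℚ.≤-Reasoning

ℚ[i]-normed : NormedℚAlgebra
ℚ[i]-normed = record
  { ring     = ℚ[i]-ring
  ; morphism = record
    { ⟦_⟧ = λ p → p +i 0ℚ ; +-homo = λ p q → refl
    ; *-homo = λ p q → cong₂ _+i_ (solve 2 (λ p q → p :* q := p :* q :- con 0ℚ :* con 0ℚ) refl p q)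
                                  (solve 2 (λ p q → con 0ℚ := p :* con 0ℚ :+ con 0ℚ :* q) refl p q)
    ; -‿homo = λ _ → refl ; 0-homo = refl ; 1-homo = refl }
  ; ‖_‖     = ∣_∣₁
  ; ‖‖-cong = cong ∣_∣₁
  ; 0≤‖_‖   = λ x → +-nonNeg (ℚ.0≤∣p∣ (re x)) (ℚ.0≤∣p∣ (im x))
  ; ‖x+y‖≤  = ∣x+y∣₁≤
  ; ‖x*y‖≤  = ∣x*y∣₁≤
  ; ‖p‖≡∣p∣ = λ p → ℚ.+-identityʳ ∣ p ∣
  }

module Cℚ[i] = Compound ℚ[i]-normed

record ℂ : Set where
  constructor _+𝕚_
  field Re Im : ℝ
open ℂ public

infix 4 _≈ᶜ_

record _≈ᶜ_ (z w : ℂ) : Set where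
  constructor mk≈ᶜ
  field
    Re≈ : Re z ≈ʳ Re w
    Im≈ : Im z ≈ʳ Im w
open _≈ᶜ_ public

infixl 6 _+ᶜ_
infixl 7 _*ᶜ_
infix  8 -ᶜ_

_+ᶜ_ _*ᶜ_ : ℂ → ℂ → ℂ
z +ᶜ w = (Re z +ʳ Re w) +𝕚 (Im z +ʳ Im w)
z *ᶜ w = (Re z *ʳ Re w -ʳ Im z *ʳ Im w) +𝕚 (Re z *ʳ Im w +ʳ Im z *ʳ Re w)

-ᶜ_ : ℂ → ℂ
-ᶜ z = (-ʳ Re z) +𝕚 (-ʳ Im z)

fromℝ : ℝ → ℂ
fromℝ x = x +𝕚 0ʳ

0ᶜ 1ᶜ : ℂ
0ᶜ = fromℝ 0ʳ
1ᶜ = fromℝ 1ʳ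

private
  module R = CommutativeRing ℝ-ring
  module S = ℝ-solver

opaque
  ℂ-*-cong : ∀ {z z′ w w′} → z ≈ᶜ z′ → w ≈ᶜ w′ → z *ᶜ w ≈ᶜ z′ *ᶜ w′
  ℂ-*-cong p q = mk≈ᶜ
    (R.+-cong (R.*-cong (Re≈ p) (Re≈ q)) (R.-‿cong (R.*-cong (Im≈ p) (Im≈ q))))
    (R.+-cong (R.*-cong (Re≈ p) (Im≈ q)) (R.*-cong (Im≈ p) (Re≈ q)))

  ℂ-*-assoc : ∀ x y z → (x *ᶜ y) *ᶜ z ≈ᶜ x *ᶜ (y *ᶜ z)
  ℂ-*-assoc x y z = mk≈ᶜ
    (S.solve 6 (λ a b c d e f → (a S.:* c S.:- b S.:* d) S.:* e S.:- (a S.:* d S.:+ b S.:* c) S.:* f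
       S.:= a S.:* (c S.:* e S.:- d S.:* f) S.:- b S.:* (c S.:* f S.:+ d S.:* e)) R.refl (Re x) (Im x) (Re y) (Im y) (Re z) (Im z))
    (S.solve 6 (λ a b c d e f → (a S.:* c S.:- b S.:* d) S.:* f S.:+ (a S.:* d S.:+ b S.:* c) S.:* e
       S.:= a S.:* (c S.:* f S.:+ d S.:* e) S.:+ b S.:* (c S.:* e S.:- d S.:* f)) R.refl (Re x) (Im x) (Re y) (Im y) (Re z) (Im z))

  ℂ-*-comm : ∀ x y → x *ᶜ y ≈ᶜ y *ᶜ x
  ℂ-*-comm x y = mk≈ᶜ
    (S.solve 4 (λ a b c d → a S.:* c S.:- b S.:* d S.:= c S.:* a S.:- d S.:* b) R.refl (Re x) (Im x) (Re y) (Im y))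
    (S.solve 4 (λ a b c d → a S.:* d S.:+ b S.:* c S.:= c S.:* b S.:+ d S.:* a) R.refl (Re x) (Im x) (Re y) (Im y))

  ℂ-*-identityˡ : ∀ x → 1ᶜ *ᶜ x ≈ᶜ x
  ℂ-*-identityˡ x = mk≈ᶜ
    (S.solve 2 (λ a b → S.con 1ℚ S.:* a S.:- S.con 0ℚ S.:* b S.:= a) R.refl (Re x) (Im x))
    (S.solve 2 (λ a b → S.con 1ℚ S.:* b S.:+ S.con 0ℚ S.:* a S.:= b) R.refl (Re x) (Im x))

  ℂ-distribˡ : ∀ x y z → x *ᶜ (y +ᶜ z) ≈ᶜ x *ᶜ y +ᶜ x *ᶜ z
  ℂ-distribˡ x y z = mk≈ᶜ
    (S.solve 6 (λ a b c d e f → a S.:* (c S.:+ e) S.:- b S.:* (d S.:+ f) S.:= (a S.:* c S.:- b S.:* d) S.:+ (a S.:* e S.:- b S.:* f))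
      R.refl (Re x) (Im x) (Re y) (Im y) (Re z) (Im z))
    (S.solve 6 (λ a b c d e f → a S.:* (d S.:+ f) S.:+ b S.:* (c S.:+ e) S.:= (a S.:* d S.:+ b S.:* c) S.:+ (a S.:* f S.:+ b S.:* e))
      R.refl (Re x) (Im x) (Re y) (Im y) (Re z) (Im z))

ℂ-ring : CommutativeRing 0ℓ 0ℓ
ℂ-ring = record
  { Carrier = ℂ ; _≈_ = _≈ᶜ_ ; _+_ = _+ᶜ_ ; _*_ = _*ᶜ_ ; -_ = -ᶜ_ ; 0# = 0ᶜ ; 1# = 1ᶜ
  ; isCommutativeRing = record
    { isRing = record
      { +-isAbelianGroup = record
        { isGroup = record
          { isMonoid = record
            { isSemigroup = record
              { isMagma = record
                { isEquivalence = isEquivalence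
                ; ∙-cong = λ p q → mk≈ᶜ (R.+-cong (Re≈ p) (Re≈ q)) (R.+-cong (Im≈ p) (Im≈ q)) }
              ; assoc = λ x y z → mk≈ᶜ (R.+-assoc (Re x) (Re y) (Re z)) (R.+-assoc (Im x) (Im y) (Im z)) }
            ; identity = (λ x → mk≈ᶜ (R.+-identityˡ (Re x)) (R.+-identityˡ (Im x)))
                       , (λ x → mk≈ᶜ (R.+-identityʳ (Re x)) (R.+-identityʳ (Im x))) }
          ; inverse = (λ x → mk≈ᶜ (R.-‿inverseˡ (Re x)) (R.-‿inverseˡ (Im x)))
                    , (λ x → mk≈ᶜ (R.-‿inverseʳ (Re x)) (R.-‿inverseʳ (Im x)))
          ; ⁻¹-cong = λ p → mk≈ᶜ (R.-‿cong (Re≈ p)) (R.-‿cong (Im≈ p)) }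
        ; comm = λ x y → mk≈ᶜ (R.+-comm (Re x) (Re y)) (R.+-comm (Im x) (Im y)) }
      ; *-cong = ℂ-*-cong
      ; *-assoc = ℂ-*-assoc
      ; *-identity = ℂ-*-identityˡ , λ x → ≈ᶜ-trans (ℂ-*-comm x 1ᶜ) (ℂ-*-identityˡ x)
      ; distrib = ℂ-distribˡ , λ x y z → ≈ᶜ-trans (ℂ-*-comm (y +ᶜ z) x) (≈ᶜ-trans (ℂ-distribˡ x y z)
                    (mk≈ᶜ (R.+-cong (Re≈ (ℂ-*-comm x y)) (Re≈ (ℂ-*-comm x z)))
                          (R.+-cong (Im≈ (ℂ-*-comm x y)) (Im≈ (ℂ-*-comm x z))))) }
    ; *-comm = ℂ-*-comm } }
  where
  ≈ᶜ-trans : ∀ {x y z} → x ≈ᶜ y → y ≈ᶜ z → x ≈ᶜ z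
  ≈ᶜ-trans p q = mk≈ᶜ (R.trans (Re≈ p) (Re≈ q)) (R.trans (Im≈ p) (Im≈ q))
  isEquivalence : IsEquivalence _≈ᶜ_
  isEquivalence = record
    { refl  = mk≈ᶜ R.refl R.refl
    ; sym   = λ p → mk≈ᶜ (R.sym (Re≈ p)) (R.sym (Im≈ p))
    ; trans = ≈ᶜ-trans }

seqᶜ : ℂ → ℕ → ℚ[i]
seqᶜ z n = seq (Re z) n +i seq (Im z) n

opaque
  boundedᶜ : ∀ z → Cℚ[i].Bounded (seqᶜ z)
  boundedᶜ z = b ℕ.+ c , M ℕ.⊔ N , λ n le → ℚ.≤-trans
    (ℚ.+-mono-≤ (proj₂ (proj₂ (bounded (Re z))) n (ℕ.≤-trans (ℕ.m≤m⊔n M N) le))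
                (proj₂ (proj₂ (bounded (Im z))) n (ℕ.≤-trans (ℕ.m≤n⊔m M N) le)))
    (ℚ.≤-reflexive (sym (fromℕ-+ b c)))
    where
    b c M N : ℕ
    b = proj₁ (bounded (Re z))
    c = proj₁ (bounded (Im z))
    M = proj₁ (proj₂ (bounded (Re z)))
    N = proj₁ (proj₂ (bounded (Im z)))

  expᶜ-cauchy : ∀ z → Small min (λ (m , n) → Cℚ[i].dist (Cℚ[i].compound m (seqᶜ z m)) (Cℚ[i].compound n (seqᶜ z n)))
  expᶜ-cauchy z = Cℚ[i].diagonal-cauchy (boundedᶜ z) (small-+ (cauchy (Re z)) (cauchy (Im z)))

  re-cauchy : ∀ z → Cauchy (λ n → re (Cℚ[i].compound n (seqᶜ z n)))
  re-cauchy z = small-≤ (λ (m , n) → ∣re∣≤ (Cℚ[i].compound m (seqᶜ z m) +ⁱ -ⁱ Cℚ[i].compound n (seqᶜ z n))) (expᶜ-cauchy z)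

  im-cauchy : ∀ z → Cauchy (λ n → im (Cℚ[i].compound n (seqᶜ z n)))
  im-cauchy z = small-≤ (λ (m , n) → ∣im∣≤ (Cℚ[i].compound m (seqᶜ z m) +ⁱ -ⁱ Cℚ[i].compound n (seqᶜ z n))) (expᶜ-cauchy z)

-- lim (1 + z / n) ^ n, as for exp.
expᶜ : ℂ → ℂ
expᶜ z = mkℝ (λ n → re (Cℚ[i].compound n (seqᶜ z n))) (re-cauchy z)
      +𝕚 mkℝ (λ n → im (Cℚ[i].compound n (seqᶜ z n))) (im-cauchy z)

opaque
  small⇒≈ᶜ : ∀ {z w} → Small id (λ n → Cℚ[i].dist (seqᶜ z n) (seqᶜ w n)) → z ≈ᶜ w
  small⇒≈ᶜ {z} {w} h = mk≈ᶜ (mk≈ (small-≤ (λ n → ∣re∣≤ (seqᶜ z n +ⁱ -ⁱ seqᶜ w n)) h))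
                            (mk≈ (small-≤ (λ n → ∣im∣≤ (seqᶜ z n +ⁱ -ⁱ seqᶜ w n)) h))

  expᶜ-cong : ∀ {z w} → z ≈ᶜ w → expᶜ z ≈ᶜ expᶜ w
  expᶜ-cong {z} {w} z≈w = small⇒≈ᶜ
    (Cℚ[i].diagonal-cong (boundedᶜ z) (boundedᶜ w) (small-+ (small (Re≈ z≈w)) (small (Im≈ z≈w))))

  expᶜ-+ : ∀ z w → expᶜ (z +ᶜ w) ≈ᶜ expᶜ z *ᶜ expᶜ w
  expᶜ-+ z w = small⇒≈ᶜ (Cℚ[i].diagonal-+ (boundedᶜ z) (boundedᶜ w))

  expᶜ-0 : expᶜ 0ᶜ ≈ᶜ 1ᶜ
  expᶜ-0 = mk≈ᶜ (pointwise λ n → cong re (one n)) (pointwise λ n → cong im (one n))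
    where
    one^ : ∀ n → (1ℚ +i 0ℚ) Cℚ[i].^ n ≡ 1ℚ +i 0ℚ
    one^ zero    = refl
    one^ (suc n) = trans (CommutativeRing.*-identityˡ ℚ[i]-ring _) (one^ n)
    one : ∀ n → Cℚ[i].compound n (0ℚ +i 0ℚ) ≡ 1ℚ +i 0ℚ
    one n = trans (cong (Cℚ[i]._^ suc n) (cong₂ _+i_
      (solve 1 (λ e → con 1ℚ :+ (e :* con 0ℚ :- con 0ℚ :* con 0ℚ) := con 1ℚ) refl (1/1+ n))
      (solve 1 (λ e → con 0ℚ :+ (e :* con 0ℚ :+ con 0ℚ :* con 0ℚ) := con 0ℚ) refl (1/1+ n)))) (one^ (suc n))

private
  module C = CommutativeRing ℂ-ring

open import Algebra.Definitions.RawSemiring (Semiring.rawSemiring R.semiring) public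
  using () renaming (_^_ to _^ʳ_)
open import Algebra.Definitions.RawSemiring (Semiring.rawSemiring C.semiring) public
  using () renaming (_^_ to _^ᶜ_; sum to ∑ᶜ)

fromℕʳ : ℕ → ℝ
fromℕʳ n = fromℚ (fromℕ n)

fromℚᶜ : ℚ → ℂ
fromℚᶜ p = fromℝ (fromℚ p)

opaque
  *ʳ-pos : ∀ {x y} → 0ʳ <ʳ x → 0ʳ <ʳ y → 0ʳ <ʳ x *ʳ y
  *ʳ-pos {x} {y} (mk< (δ , 0<δ , M , δ≤x)) (mk< (ε , 0<ε , N , ε≤y)) = mk< (
    δ * ε , *-pos 0<δ 0<ε , M ℕ.⊔ N , λ n le → subst (_≤ seq x n * seq y n) (sym (ℚ.+-identityˡ (δ * ε)))
      (*-mono (ℚ.<⇒≤ 0<δ) (ℚ.<⇒≤ 0<ε)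
        (subst (_≤ seq x n) (ℚ.+-identityˡ δ) (δ≤x n (ℕ.≤-trans (ℕ.m≤m⊔n M N) le)))
        (subst (_≤ seq y n) (ℚ.+-identityˡ ε) (ε≤y n (ℕ.≤-trans (ℕ.m≤n⊔m M N) le)))))

  ^ʳ-pos : ∀ {x} n → 0ʳ <ʳ x → 0ʳ <ʳ x ^ʳ n
  ^ʳ-pos zero    _   = mk< (1ℚ , ℚ.positive⁻¹ 1ℚ , 0 , λ _ _ → ℚ.≤-refl)
  ^ʳ-pos (suc n) 0<x = *ʳ-pos 0<x (^ʳ-pos n 0<x)

-- a ^ s; in particular 1 / a ^ s is rpow a _ (-ʳ s).
rpow : (a : ℝ) → 0ʳ <ʳ a → ℝ → ℝ
rpow a 0<a s = exp (s *ʳ ln a 0<a)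

-- A choice of log β.  There is none for β = 0, where 0 ^ s is given directly.
data Log (β : ℂ) : Set where
  zeroBase : β ≈ᶜ 0ᶜ → Log β
  log      : (ℓ : ℂ) → expᶜ ℓ ≈ᶜ β → Log β

opaque
  fromℕ-suc-* : ∀ n z → fromℝ (fromℕʳ (suc n)) *ᶜ z ≈ᶜ z +ᶜ fromℝ (fromℕʳ n) *ᶜ z
  fromℕ-suc-* n z = C.trans
    (C.*-congʳ (mk≈ᶜ (pointwise λ _ → fromℕ-+ 1 n) (R.sym (R.+-identityʳ 0ʳ))))
    (C.trans (C.distribʳ z 1ᶜ (fromℝ (fromℕʳ n))) (C.+-congʳ (C.*-identityˡ z)))

  fromℕ-0-* : ∀ z → fromℝ (fromℕʳ 0) *ᶜ z ≈ᶜ 0ᶜ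
  fromℕ-0-* z = C.zeroˡ z

  exp-× : ∀ {β ℓ} → expᶜ ℓ ≈ᶜ β → ∀ n → expᶜ (fromℝ (fromℕʳ n) *ᶜ ℓ) ≈ᶜ β ^ᶜ n
  exp-× {β} {ℓ} _ zero    = C.trans (expᶜ-cong (fromℕ-0-* ℓ)) expᶜ-0
  exp-× {β} {ℓ} h (suc n) = C.trans (expᶜ-cong (fromℕ-suc-* n ℓ))
    (C.trans (expᶜ-+ ℓ (fromℝ (fromℕʳ n) *ᶜ ℓ)) (C.*-cong h (exp-× h n)))

  ^-zero : ∀ {β} → β ≈ᶜ 0ᶜ → ∀ n → .{{_ : ℕ.NonZero n}} → β ^ᶜ n ≈ᶜ 0ᶜ
  ^-zero {β} β≈0 (suc n) = C.trans (C.*-congʳ β≈0) (C.zeroˡ (β ^ᶜ n))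

-- d log β as the choice of log (β ^ d), so that (β ^ d) ^ s = β ^ (d s).
_^Log_ : ∀ {β} → Log β → (d : ℕ) → .{{_ : ℕ.NonZero d}} → Log (β ^ᶜ d)
zeroBase β≈0 ^Log d = zeroBase (^-zero β≈0 d)
log ℓ eˡ≈β   ^Log d = log (fromℝ (fromℕʳ d) *ᶜ ℓ) (exp-× eˡ≈β d)

-- cpow _ b m is β ^ (b m), for b > 0: exponents are kept in this form because
-- 0 ^ s needs the decision whether s = 0.
cpow : ∀ {β} → Log β → ℝ → ℕ → ℂ
cpow (zeroBase _) b zero    = 1ᶜ
cpow (zeroBase _) b (suc m) = 0ᶜ
cpow (log ℓ _)    b m       = expᶜ (fromℝ (b *ʳ fromℕʳ m) *ᶜ ℓ)

Series : Set
Series = ℕ → ℂ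

infix  4 _≋_
infixl 6 _+ˢ_ _-ˢ_
infixl 7 _*ˢ_

_≋_ : Series → Series → Set
f ≋ g = ∀ n → f n ≈ᶜ g n

_+ˢ_ _-ˢ_ _*ˢ_ : Series → Series → Series
(f +ˢ g) n = f n +ᶜ g n
(f -ˢ g) n = f n +ᶜ -ᶜ g n
(f *ˢ g) n = ∑ᶜ {suc n} λ i → f (toℕ i) *ᶜ g (n ℕ.∸ toℕ i)

const : ℂ → Series
const c zero    = c
const c (suc _) = 0ᶜ

t : Series
t 1 = 1ᶜ
t _ = 0ᶜ

Series-rawSemiring : RawSemiring 0ℓ 0ℓ
Series-rawSemiring = record { _≈_ = _≋_ ; _+_ = _+ˢ_ ; _*_ = _*ˢ_ ; 0# = const 0ᶜ ; 1# = const 1ᶜ }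

open import Algebra.Definitions.RawSemiring Series-rawSemiring public
  using () renaming (_^_ to _^ˢ_; sum to ∑ˢ)

1/_! : ℕ → ℚ
1/ n ! = (+ 1 / (n ℕ.!)) {{n ℕ.!≢0}}

-- ∑ y n tⁿ / n!
egf : (ℕ → ℂ) → Series
egf y n = fromℚᶜ (1/ n !) *ᶜ y n

exp[_·t] : ℝ → Series
exp[ x ·t] = egf (λ n → fromℝ x ^ᶜ n)

infix 4 _expands_÷_

-- S is the power series expansion of N / D: the quotient is cleared, since D may
-- vanish at t = 0.
_expands_÷_ : Series → Series → Series → Set
S expands N ÷ D = D *ˢ S ≋ N

2[t/2]^ : ℕ → Series
2[t/2]^ k = const (fromℚᶜ (fromℕ 2)) *ˢ (const (fromℚᶜ ½) *ˢ t) ^ˢ k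

-- (β / a) ^ (b m)
ratioPow : ∀ {β} → Log β → (a : ℝ) → 0ʳ <ʳ a → ℝ → ℕ → ℂ
ratioPow Λ a 0<a b m = cpow Λ b m *ᶜ fromℝ (rpow a 0<a (-ʳ (b *ʳ fromℕʳ m)))

-- y n = y_{n,β}(x : k, a, b) for all n.  The denominators here and below are
-- nonzero series, because a ^ b ≠ 0.
IsY : ∀ {β} → Log β → (x : ℝ) (k : ℕ) (a : ℝ) → 0ʳ <ʳ a → (b : ℝ) → (ℕ → ℂ) → Set
IsY Λ x k a 0<a b y =
  egf y expands
    2[t/2]^ k *ˢ exp[ x ·t]
  ÷ (const (cpow Λ b 1) *ˢ exp[ 1ʳ ·t] -ˢ const (fromℝ (rpow a 0<a b)))

-- y n = y_{n,χ,β}(x : k, a, b) for all n, where χ has conductor d.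
IsGeneralizedY : (d : ℕ) (χ : ℤ → ℂ) → ∀ {β} → Log β →
                 (x : ℝ) (k : ℕ) (a : ℝ) → 0ʳ <ʳ a → (b : ℝ) → (ℕ → ℂ) → Set
IsGeneralizedY d χ Λ x k a 0<a b y =
  egf y expands
    2[t/2]^ k *ˢ ∑ˢ {d} (λ j →
      const (χ (+ toℕ j) *ᶜ ratioPow Λ a 0<a b (toℕ j)) *ˢ exp[ x +ʳ fromℕʳ (toℕ j) ·t])
  ÷ (const (cpow Λ b d) *ˢ exp[ fromℕʳ d ·t] -ˢ const (fromℝ (rpow a 0<a (b *ʳ fromℕʳ d))))

record IsDirichletCharacter (d : ℕ) (χ : ℤ → ℂ) : Set where
  field
    periodic       : ∀ m → χ (m ℤ.+ + d) ≈ᶜ χ m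
    unit           : χ (+ 1) ≈ᶜ 1ᶜ
    multiplicative : ∀ m n → χ (m ℤ.* n) ≈ᶜ χ m *ᶜ χ n
    vanishes       : ∀ m → ¬ ℤ.Coprime m (+ d) → χ m ≈ᶜ 0ᶜ

IsInducedModulus : (d : ℕ) (χ : ℤ → ℂ) → ℕ → Set
IsInducedModulus d χ e = (e ℕ.∣ d) ×
  (∀ m n → ℤ.Coprime m (+ d) → ℤ.Coprime n (+ d) → + e ℤ.∣ (m ℤ.- n) → χ m ≈ᶜ χ n)

-- A character modulo d, regarded as d-periodic, has conductor d when d is its
-- least induced modulus (d itself always is one).
HasConductor : (d : ℕ) (χ : ℤ → ℂ) → Set
HasConductor d χ = IsDirichletCharacter d χ × (∀ e → IsInducedModulus d χ e → d ℕ.≤ e)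

_^ᶻ_ : (d : ℕ) → .{{_ : ℕ.NonZero d}} → ℤ → ℚ
d ^ᶻ (+ n)      = fromℕ (d ℕ.^ n)
d ^ᶻ (-[1+ n ]) = (+ 1 / (d ℕ.^ suc n)) {{ℕ.m^n≢0 d (suc n)}}

{-# OPTIONS --safe #-}

-- Write A = aᵇᵈ, B = βᵇᵈ and D(t) = B eᵈᵗ - A.  Since (aᵈ)ᵇ = A and (βᵈ)ᵇ = B, replacing t by dt in
-- the generating function of y_{n,βᵈ}((x+j)/d : k, aᵈ, b) gives a series with denominator D(t) and
-- numerator dᵏ · 2(t/2)ᵏ e^((x+j)t).  Summing against χ(j)(β/a)ᵇʲ gives dᵏ times the generating
-- function of y_{n,χ,β}, once D is cancelled.  Whether D₀ = B - A vanishes is undecidable, so the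
-- cancellation uses no case split: D₀ and D₁ = dB generate the invertible A, and ℂ is reduced.
module Submission where

open import Defs
open import Algebra.Bundles using (CommutativeRing)
import Algebra.Properties.CommutativeSemiring.Exp
import Algebra.Properties.Ring
import Algebra.Properties.Semiring.Sum
open import Algebra.Solver.Ring.AlmostCommutativeRing
  using (fromCommutativeRing; _-Raw-AlmostCommutative⟶_)
open import Data.Fin.Base as Fin using (Fin; toℕ; inject₁)
open import Data.Fin.Properties using (toℕ-inject₁; toℕ-fromℕ; toℕ≤pred[n])
open import Data.Integer.Base using (ℤ; +_; _-_; _⊖_)
import Data.Integer.Properties as ℤ
open import Data.Nat.Base as ℕ using (ℕ; NonZero; zero; suc; _∸_)
import Data.Nat.Properties as ℕ
open import Data.Product.Base using (_,_; proj₁; proj₂)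
open import Data.Rational.Base as ℚ using (0ℚ; 1ℚ; ½; _/_; ∣_∣)
import Data.Rational.Properties as ℚ
open import Data.Rational.Solver using (module +-*-Solver)
open import Function.Base using (_∘_)
open import Relation.Binary.PropositionalEquality as ≡ using (_≡_; refl; cong; cong₂)
import Relation.Binary.Reasoning.Setoid as ≈-Reasoning

private
  module R = CommutativeRing ℝ-ring
  module C where
    open CommutativeRing ℂ-ring public
    open Algebra.Properties.CommutativeSemiring.Exp commutativeSemiring public
    open Algebra.Properties.Ring ring public using (x∙y⁻¹≈ε⇒x≈y)
    open Algebra.Properties.Semiring.Sum semiring public

-- Rational and real scalars inside ℂ.

ℚ⟶ℂ : CommutativeRing.rawRing ℚ-ring -Raw-AlmostCommutative⟶ fromCommutativeRing ℂ-ring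
ℚ⟶ℂ = record
  { ⟦_⟧    = fromℚᶜ
  ; +-homo = λ p q → mk≈ᶜ (pointwise λ _ → refl) (pointwise λ _ → refl)
  ; *-homo = λ p q → mk≈ᶜ
      (pointwise λ _ → +-*-Solver.solve 2 (λ p q → p :* q := p :* q :- con 0ℚ :* con 0ℚ) refl p q)
      (pointwise λ _ → +-*-Solver.solve 2 (λ p q → con 0ℚ := p :* con 0ℚ :+ con 0ℚ :* q) refl p q)
  ; -‿homo = λ p → mk≈ᶜ (pointwise λ _ → refl) (pointwise λ _ → refl)
  ; 0-homo = C.refl
  ; 1-homo = C.refl
  }
  where open +-*-Solver

module ℂ-solver = ℚ-Solver ℂ-ring ℚ⟶ℂ

fromℝ-cong : ∀ {x y} → x ≈ʳ y → fromℝ x ≈ᶜ fromℝ y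
fromℝ-cong x≈y = mk≈ᶜ x≈y R.refl

fromℝ-* : ∀ x y → fromℝ (x *ʳ y) ≈ᶜ fromℝ x *ᶜ fromℝ y
fromℝ-* x y = mk≈ᶜ
  (solve 2 (λ x y → x :* y := x :* y :- con 0ℚ :* con 0ℚ) R.refl x y)
  (solve 2 (λ x y → con 0ℚ := x :* con 0ℚ :+ con 0ℚ :* y) R.refl x y)
  where open ℝ-solver

-- Integer powers of d.

^-fromℕ : ∀ d n → fromℕ d ^ℚ n ≡ fromℕ (d ℕ.^ n)
^-fromℕ d zero    = refl
^-fromℕ d (suc n) = ≡.trans (cong (fromℕ d ℚ.*_) (^-fromℕ d n)) (≡.sym (fromℕ-* d (d ℕ.^ n)))

fromℚᶜ-^ : ∀ p n → fromℚᶜ p ^ᶜ n ≈ᶜ fromℚᶜ (p ^ℚ n)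
fromℚᶜ-^ p zero    = C.refl
fromℚᶜ-^ p (suc n) = C.trans (C.*-congˡ (fromℚᶜ-^ p n)) (C.sym (*-homo p (p ^ℚ n)))
  where open _-Raw-AlmostCommutative⟶_ ℚ⟶ℂ

fromℚᶜ-inverse : ∀ {p q} → p ℚ.* q ≡ 1ℚ → fromℚᶜ p *ᶜ fromℚᶜ q ≈ᶜ 1ᶜ
fromℚᶜ-inverse {p} {q} pq≡1 = C.trans (C.sym (*-homo p q)) (C.reflexive (cong fromℚᶜ pq≡1))
  where open _-Raw-AlmostCommutative⟶_ ℚ⟶ℂ

-- Phrased with `⊖` so that the induction can lower both arguments together: one factor d cancels at
-- each step, and the two signs of the exponent are the two base cases.
^ᶻ-⊖ : ∀ d .{{_ : NonZero d}} n k → (d ^ᶻ (n ⊖ k)) ℚ.* fromℕ (d ℕ.^ k) ≡ fromℕ (d ℕ.^ n)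
^ᶻ-⊖ d n       zero    = ℚ.*-identityʳ _
^ᶻ-⊖ d zero    (suc k) = 1/-inverse 1 (d ℕ.^ suc k) {{ℕ.m^n≢0 d (suc k)}}
^ᶻ-⊖ d (suc n) (suc k) = begin
  (d ^ᶻ (suc n ⊖ suc k)) ℚ.* fromℕ (d ℕ.^ suc k)   ≡⟨ cong₂ (λ z q → (d ^ᶻ z) ℚ.* q) (ℤ.[1+m]⊖[1+n]≡m⊖n n k) (fromℕ-* d (d ℕ.^ k)) ⟩
  (d ^ᶻ (n ⊖ k)) ℚ.* (fromℕ d ℚ.* fromℕ (d ℕ.^ k)) ≡⟨ solve 3 (λ x y z → x :* (y :* z) := y :* (x :* z)) refl (d ^ᶻ (n ⊖ k)) (fromℕ d) (fromℕ (d ℕ.^ k)) ⟩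
  fromℕ d ℚ.* ((d ^ᶻ (n ⊖ k)) ℚ.* fromℕ (d ℕ.^ k)) ≡⟨ cong (fromℕ d ℚ.*_) (^ᶻ-⊖ d n k) ⟩
  fromℕ d ℚ.* fromℕ (d ℕ.^ n)                      ≡⟨ fromℕ-* d (d ℕ.^ n) ⟨
  fromℕ (d ℕ.^ suc n)                              ∎
  where
  open ≡.≡-Reasoning
  open +-*-Solver

-- Besides producing dⁿ⁻ᵏ, the case n = 0 exhibits an inverse of dᵏ.
^ᶻ-difference : ∀ d .{{_ : NonZero d}} n k →
  fromℚᶜ (d ^ᶻ (+ n - + k)) *ᶜ fromℚᶜ (fromℕ d) ^ᶜ k ≈ᶜ fromℚᶜ (fromℕ d) ^ᶜ n
^ᶻ-difference d n k = begin
  fromℚᶜ p *ᶜ fromℚᶜ (fromℕ d) ^ᶜ k       ≈⟨ C.*-congˡ (fromℚᶜ-^ (fromℕ d) k) ⟩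
  fromℚᶜ p *ᶜ fromℚᶜ (fromℕ d ^ℚ k)       ≈⟨ *-homo p (fromℕ d ^ℚ k) ⟨
  fromℚᶜ (p ℚ.* fromℕ d ^ℚ k)             ≡⟨ cong fromℚᶜ p*dᵏ≡dⁿ ⟩
  fromℚᶜ (fromℕ d ^ℚ n)                   ≈⟨ fromℚᶜ-^ (fromℕ d) n ⟨
  fromℚᶜ (fromℕ d) ^ᶜ n                   ∎
  where
  open _-Raw-AlmostCommutative⟶_ ℚ⟶ℂ
  open ≈-Reasoning C.setoid
  p = d ^ᶻ (+ n - + k)
  p*dᵏ≡dⁿ : p ℚ.* fromℕ d ^ℚ k ≡ fromℕ d ^ℚ n
  p*dᵏ≡dⁿ = ≡.trans (cong₂ (λ z q → (d ^ᶻ z) ℚ.* q) (ℤ.m-n≡m⊖n n k) (^-fromℕ d k))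
    (≡.trans (^ᶻ-⊖ d n k) (≡.sym (^-fromℕ d n)))

-- ℂ is reduced.

-- For tolerance δ, ask that the squares of the approximations be below δ²; an approximation of size
-- at least δ would then contradict this. The comparison is between rationals, where it is
-- decidable.
x²≈0⇒x≈0 : ∀ {x} → x *ʳ x ≈ʳ 0ʳ → x ≈ʳ 0ʳ
x²≈0⇒x≈0 {x} x²≈0 = mk≈ λ {δ} 0<δ →
  let N , x²<δ² = small x²≈0 (*-pos 0<δ 0<δ) in
  N , λ n N≤n → ℚ.≰⇒> λ δ≤x → ℚ.<-irrefl refl (ℚ.<-≤-trans (x²<δ² n N≤n) (begin
    δ ℚ.* δ                                     ≤⟨ *-mono (ℚ.<⇒≤ 0<δ) (ℚ.<⇒≤ 0<δ) δ≤x δ≤x ⟩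
    ∣ seq x n ℚ.- 0ℚ ∣ ℚ.* ∣ seq x n ℚ.- 0ℚ ∣    ≡⟨ ℚ.∣p*q∣≡∣p∣*∣q∣ (seq x n ℚ.- 0ℚ) (seq x n ℚ.- 0ℚ) ⟨
    ∣ (seq x n ℚ.- 0ℚ) ℚ.* (seq x n ℚ.- 0ℚ) ∣    ≡⟨ cong ∣_∣ (solve 1 (λ x → (x :- con 0ℚ) :* (x :- con 0ℚ) := x :* x :- con 0ℚ) refl (seq x n)) ⟩
    ∣ seq x n ℚ.* seq x n ℚ.- 0ℚ ∣               ∎))
  where
  open ℚ.≤-Reasoning
  open +-*-Solver

-- Each rational approximation satisfies 0 ≤ x² ≤ x² + y², so x² tends to 0 as well.
x²+y²≈0⇒x≈0 : ∀ {x y} → x *ʳ x +ʳ y *ʳ y ≈ʳ 0ʳ → x ≈ʳ 0ʳ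
x²+y²≈0⇒x≈0 {x} {y} h = x²≈0⇒x≈0 (mk≈ (small-≤ x²≤ (small h)))
  where
  open ℚ.≤-Reasoning
  x²≤ : ∀ n → ∣ seq x n ℚ.* seq x n ℚ.- 0ℚ ∣ ℚ.≤ ∣ seq x n ℚ.* seq x n ℚ.+ seq y n ℚ.* seq y n ℚ.- 0ℚ ∣
  x²≤ n = begin
    ∣ a ℚ.- 0ℚ ∣        ≡⟨ cong ∣_∣ (ℚ.+-identityʳ a) ⟩
    ∣ a ∣               ≡⟨ ℚ.0≤p⇒∣p∣≡p (p*p≥0 (seq x n)) ⟩
    a                   ≤⟨ ≤-+ˡ (p*p≥0 (seq y n)) ⟩
    a ℚ.+ b             ≤⟨ p≤∣p∣ (a ℚ.+ b) ⟩
    ∣ a ℚ.+ b ∣         ≡⟨ cong ∣_∣ (ℚ.+-identityʳ (a ℚ.+ b)) ⟨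
    ∣ a ℚ.+ b ℚ.- 0ℚ ∣  ∎
    where
    a = seq x n ℚ.* seq x n
    b = seq y n ℚ.* seq y n

-- With z = x + iy, (x² + y²)² = (x² - y²)² + (2xy)² = (Re z²)² + (Im z²)².
z²≈0⇒z≈0 : ∀ {z} → z *ᶜ z ≈ᶜ 0ᶜ → z ≈ᶜ 0ᶜ
z²≈0⇒z≈0 {z@(x +𝕚 y)} z²≈0 = mk≈ᶜ (x²+y²≈0⇒x≈0 ∣z∣²≈0)
  (x²+y²≈0⇒x≈0 (R.trans (R.+-comm (y *ʳ y) (x *ʳ x)) ∣z∣²≈0))
  where
  open ℝ-solver
  u = Re (z *ᶜ z)
  v = Im (z *ᶜ z)
  ∣z∣²≈0 : x *ʳ x +ʳ y *ʳ y ≈ʳ 0ʳ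
  ∣z∣²≈0 = x²≈0⇒x≈0 (R.trans
    (solve 2 (λ x y → (x :* x :+ y :* y) :* (x :* x :+ y :* y)
        := (x :* x :- y :* y) :* (x :* x :- y :* y) :+ (x :* y :+ y :* x) :* (x :* y :+ y :* x)) R.refl x y)
    (R.trans (R.+-cong (R.trans (R.*-congʳ (Re≈ z²≈0)) (R.zeroˡ u)) (R.trans (R.*-congʳ (Im≈ z²≈0)) (R.zeroˡ v)))
      (R.+-identityˡ 0ʳ)))

-- Uniqueness of real logarithms; powers of a and β.

-- By `compound-expand′`, (1 + x/n)ⁿ does not shrink distances between nonnegative numbers. Adding a
-- large constant c makes the approximations of x and y nonnegative from some index on, and
-- multiplies both exponentials by the same factor.
exp-injective : ∀ {x y} → exp x ≈ʳ exp y → x ≈ʳ y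
exp-injective {x} {y} eˣ≈eʸ = Algebra.Properties.Ring.+-cancelʳ R.ring c x y (mk≈ (small-dom (M ℕ.⊔ N , λ n M⊔N≤n →
    compound-expand′ n
      (0≤+c x (proj₁ (bounded x)) (ℕ.m≤m+n _ _) n (proj₂ (proj₂ (bounded x)) n (ℕ.≤-trans (ℕ.m≤m⊔n M N) M⊔N≤n)))
      (0≤+c y (proj₁ (bounded y)) (ℕ.m≤n+m _ _) n (proj₂ (proj₂ (bounded y)) n (ℕ.≤-trans (ℕ.m≤n⊔m M N) M⊔N≤n))))
  (small eˣ⁺ᶜ≈eʸ⁺ᶜ)))
  where
  M N b : ℕ
  M = proj₁ (proj₂ (bounded x))
  N = proj₁ (proj₂ (bounded y))
  -- The sum of the two bounds dominates each of them, so one shift serves both x and y.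
  b = proj₁ (bounded x) ℕ.+ proj₁ (bounded y)
  c : ℝ
  c = fromℚ (fromℕ b)
  0≤+c : ∀ z m → m ℕ.≤ b → ∀ n → ∣ seq z n ∣ ℚ.≤ fromℕ m → 0ℚ ℚ.≤ seq (z +ʳ c) n
  0≤+c z m m≤b n z≤m = begin
    0ℚ                              ≡⟨ ℚ.+-inverseʳ (seq z n) ⟨
    seq z n ℚ.- seq z n             ≤⟨ ℚ.+-monoʳ-≤ (seq z n) (p≤∣p∣ (ℚ.- seq z n)) ⟩
    seq z n ℚ.+ ∣ ℚ.- seq z n ∣     ≡⟨ cong (seq z n ℚ.+_) (ℚ.∣-p∣≡∣p∣ (seq z n)) ⟩
    seq z n ℚ.+ ∣ seq z n ∣         ≤⟨ ℚ.+-monoʳ-≤ (seq z n) (ℚ.≤-trans z≤m (fromℕ-mono m≤b)) ⟩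
    seq z n ℚ.+ fromℕ b             ∎
    where open ℚ.≤-Reasoning
  eˣ⁺ᶜ≈eʸ⁺ᶜ : exp (x +ʳ c) ≈ʳ exp (y +ʳ c)
  eˣ⁺ᶜ≈eʸ⁺ᶜ = R.trans (exp-+ x c) (R.trans (R.*-congʳ eˣ≈eʸ) (R.sym (exp-+ y c)))

exp-^ : ∀ n x → exp (fromℕʳ n *ʳ x) ≈ʳ exp x ^ʳ n
exp-^ zero    x = R.trans (exp-cong (R.zeroˡ x)) exp-0
exp-^ (suc n) x = begin
  exp (fromℕʳ (suc n) *ʳ x)          ≈⟨ exp-cong (R.*-congʳ {x} (pointwise λ _ → fromℕ-+ 1 n)) ⟩
  exp ((1ʳ +ʳ fromℕʳ n) *ʳ x)        ≈⟨ exp-cong (solve 2 (λ n x → (con 1ℚ :+ n) :* x := x :+ n :* x) R.refl (fromℕʳ n) x) ⟩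
  exp (x +ʳ fromℕʳ n *ʳ x)           ≈⟨ exp-+ x (fromℕʳ n *ʳ x) ⟩
  exp x *ʳ exp (fromℕʳ n *ʳ x)       ≈⟨ R.*-congˡ (exp-^ n x) ⟩
  exp x *ʳ exp x ^ʳ n                ∎
  where
  open ℝ-solver
  open ≈-Reasoning R.setoid

^ʳ-cong : ∀ n {x y} → x ≈ʳ y → x ^ʳ n ≈ʳ y ^ʳ n
^ʳ-cong zero    _   = R.refl
^ʳ-cong (suc n) x≈y = R.*-cong x≈y (^ʳ-cong n x≈y)

-- The logarithm of a power is built from its own approximations, so its relation to the logarithm
-- of the base has to come from the injectivity of `exp`.
log-^ : ∀ {a l m} n → exp l ≈ʳ a → exp m ≈ʳ a ^ʳ n → m ≈ʳ fromℕʳ n *ʳ l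
log-^ {a} {l} {m} n eˡ≈a eᵐ≈aⁿ = exp-injective {m} {fromℕʳ n *ʳ l}
  (R.trans eᵐ≈aⁿ (R.trans (R.sym (^ʳ-cong n {exp l} {a} eˡ≈a)) (R.sym (exp-^ n l))))

-- `ln` also depends on the positivity witness; by `log-^` every witness `0<aⁿ` leads to n times the
-- logarithm of a.
rpow-^ : ∀ {a aⁿ} (0<a : 0ʳ <ʳ a) (0<aⁿ : 0ʳ <ʳ aⁿ) n s → aⁿ ≈ʳ a ^ʳ n →
         rpow aⁿ 0<aⁿ s ≈ʳ rpow a 0<a (s *ʳ fromℕʳ n)
rpow-^ {a} {aⁿ} 0<a 0<aⁿ n s aⁿ≈ = exp-cong {s *ʳ ln aⁿ 0<aⁿ} {s *ʳ fromℕʳ n *ʳ ln a 0<a}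
  (R.trans {s *ʳ ln aⁿ 0<aⁿ}
    (R.*-congˡ {s} {ln aⁿ 0<aⁿ} {fromℕʳ n *ʳ ln a 0<a}
      (log-^ {a} {ln a 0<a} {ln aⁿ 0<aⁿ} n (exp-ln a 0<a) (R.trans {exp (ln aⁿ 0<aⁿ)} (exp-ln aⁿ 0<aⁿ) aⁿ≈)))
    (R.sym (R.*-assoc s (fromℕʳ n) (ln a 0<a))))

rpow-inverse : ∀ a (0<a : 0ʳ <ʳ a) s → rpow a 0<a (-ʳ s) *ʳ rpow a 0<a s ≈ʳ 1ʳ
rpow-inverse a 0<a s = R.trans (R.sym (exp-+ (-ʳ s *ʳ ln a 0<a) (s *ʳ ln a 0<a)))
  (R.trans (exp-cong (solve 2 (λ s l → :- s :* l :+ s :* l := con 0ℚ) R.refl s (ln a 0<a))) exp-0)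
  where open ℝ-solver

-- `_^Log_` chooses dℓ as the logarithm of βᵈ, so both sides exponentiate bdℓ. For β = 0 both sides
-- are 0, since d is a successor.
cpow-^Log : ∀ {β} (Λ : Log β) b d .{{_ : NonZero d}} → cpow (Λ ^Log d) b 1 ≈ᶜ cpow Λ b d
cpow-^Log (zeroBase _) b (suc d) = C.refl
cpow-^Log (log ℓ _)    b d@(suc _) = expᶜ-cong (begin
  fromℝ (b *ʳ 1ʳ) *ᶜ (fromℝ (fromℕʳ d) *ᶜ ℓ)   ≈⟨ C.*-congʳ (fromℝ-cong (R.*-identityʳ b)) ⟩
  fromℝ b *ᶜ (fromℝ (fromℕʳ d) *ᶜ ℓ)           ≈⟨ C.*-assoc (fromℝ b) (fromℝ (fromℕʳ d)) ℓ ⟨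
  fromℝ b *ᶜ fromℝ (fromℕʳ d) *ᶜ ℓ             ≈⟨ C.*-congʳ (fromℝ-* b (fromℕʳ d)) ⟨
  fromℝ (b *ʳ fromℕʳ d) *ᶜ ℓ                   ∎)
  where open ≈-Reasoning C.setoid

-- Finite sums and convolution of series.

∑ᶜ-cong : ∀ {m} {f g : Fin m → ℂ} → (∀ i → f i ≈ᶜ g i) → ∑ᶜ f ≈ᶜ ∑ᶜ g
∑ᶜ-cong = C.sum-cong-≋

∑ᶜ-zero : ∀ {m} {f : Fin m → ℂ} → (∀ i → f i ≈ᶜ 0ᶜ) → ∑ᶜ f ≈ᶜ 0ᶜ
∑ᶜ-zero {m} f≈0 = C.trans (∑ᶜ-cong f≈0) (C.sum-replicate-zero m)

∑ˢ-coeff : ∀ {m} (f : Fin m → Series) n → ∑ˢ f n ≈ᶜ ∑ᶜ λ j → f j n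
∑ˢ-coeff {zero}  f zero    = C.refl
∑ˢ-coeff {zero}  f (suc n) = C.refl
∑ˢ-coeff {suc m} f n       = C.+-congˡ (∑ˢ-coeff (f ∘ Fin.suc) n)

*ˢ-cong : ∀ {f f′ g g′} → f ≋ f′ → g ≋ g′ → f *ˢ g ≋ f′ *ˢ g′
*ˢ-cong f≋f′ g≋g′ n = ∑ᶜ-cong {suc n} λ i → C.*-cong (f≋f′ (toℕ i)) (g≋g′ (n ∸ toℕ i))

const-*ˢ : ∀ c f n → (const c *ˢ f) n ≈ᶜ c *ᶜ f n
const-*ˢ c f n = C.trans (C.+-congˡ (∑ᶜ-zero {n} λ i → C.zeroˡ (f (n ∸ suc (toℕ i))))) (C.+-identityʳ (c *ᶜ f n))

infixr 7 _•_

-- Replaces multiplication by `const c`, whose coefficients are whole convolution sums; `const-*ˢ`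
-- translates between the two.
_•_ : ℂ → Series → Series
(c • f) n = c *ᶜ f n

*ˢ-• : ∀ c f g → f *ˢ (c • g) ≋ c • (f *ˢ g)
*ˢ-• c f g n = C.trans
  (∑ᶜ-cong {suc n} λ i → solve 3 (λ c x y → x :* (c :* y) := c :* (x :* y)) C.refl c (f (toℕ i)) (g (n ∸ toℕ i)))
  (C.sym (C.*-distribˡ-sum {suc n} c (λ i → f (toℕ i) *ᶜ g (n ∸ toℕ i))))
  where open ℂ-solver

*ˢ-∑ : ∀ {m} f (g : Fin m → Series) n → (f *ˢ (λ l → ∑ᶜ λ j → g j l)) n ≈ᶜ ∑ᶜ λ j → (f *ˢ g j) n
*ˢ-∑ {m} f g n = C.trans
  (∑ᶜ-cong {suc n} λ i → C.*-distribˡ-sum {m} (f (toℕ i)) (λ j → g j (n ∸ toℕ i)))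
  (C.∑-comm {suc n} {m} (λ i j → f (toℕ i) *ᶜ g j (n ∸ toℕ i)))

*ˢ-∑-• : ∀ {m} f (c : Fin m → ℂ) (g : Fin m → Series) n →
         (f *ˢ (λ l → ∑ᶜ λ j → (c j • g j) l)) n ≈ᶜ ∑ᶜ λ j → c j *ᶜ (f *ˢ g j) n
*ˢ-∑-• f c g n = C.trans (*ˢ-∑ f (λ j → c j • g j) n) (∑ᶜ-cong λ j → *ˢ-• (c j) f (g j) n)

*ˢ-distribˡ--ˢ : ∀ f g h → f *ˢ (g -ˢ h) ≋ f *ˢ g -ˢ f *ˢ h
*ˢ-distribˡ--ˢ f g h n = begin
  ∑ᶜ {suc n} (λ i → f (toℕ i) *ᶜ (g (n ∸ toℕ i) +ᶜ -ᶜ h (n ∸ toℕ i)))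
    -- Negation is written as multiplication by -1, so that distributivity can move it out of the
    -- sum.
    ≈⟨ ∑ᶜ-cong {suc n} (λ i → solve 3 (λ x y z → x :* (y :- z) := x :* y :+ con (ℚ.- 1ℚ) :* (x :* z)) C.refl
         (f (toℕ i)) (g (n ∸ toℕ i)) (h (n ∸ toℕ i))) ⟩
  ∑ᶜ {suc n} (λ i → F i +ᶜ -1ᶜ *ᶜ H i)
    ≈⟨ C.∑-distrib-+ {suc n} F (λ i → -1ᶜ *ᶜ H i) ⟩
  ∑ᶜ F +ᶜ ∑ᶜ (λ i → -1ᶜ *ᶜ H i)
    ≈⟨ C.+-congˡ (C.*-distribˡ-sum {suc n} -1ᶜ H) ⟨
  ∑ᶜ F +ᶜ -1ᶜ *ᶜ ∑ᶜ H
    ≈⟨ solve 2 (λ x y → x :+ con (ℚ.- 1ℚ) :* y := x :- y) C.refl (∑ᶜ F) (∑ᶜ H) ⟩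
  ∑ᶜ F +ᶜ -ᶜ ∑ᶜ H ∎
  where
  open ℂ-solver
  open ≈-Reasoning C.setoid
  -1ᶜ = fromℚᶜ (ℚ.- 1ℚ)
  F H : Fin (suc n) → ℂ
  F i = f (toℕ i) *ᶜ g (n ∸ toℕ i)
  H i = f (toℕ i) *ᶜ h (n ∸ toℕ i)

-- Cancellation of power series.

-- When h₀ = 0, h is t times its shift, and a factor t moves every coefficient up one place. The
-- last summand of the convolution is the one containing h₀.
*ˢ-tail : ∀ f {h} → h 0 ≈ᶜ 0ᶜ → ∀ n → (f *ˢ h) (suc n) ≈ᶜ (f *ˢ (h ∘ suc)) n
*ˢ-tail f {h} h₀≈0 n = begin
  ∑ᶜ term                                              ≈⟨ C.sum-init-last {suc n} term ⟩
  ∑ᶜ {suc n} (term ∘ inject₁) +ᶜ term (Fin.fromℕ (suc n))  ≈⟨ C.+-cong (∑ᶜ-cong {suc n} init≈) last≈0 ⟩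
  (f *ˢ (h ∘ suc)) n +ᶜ 0ᶜ                             ≈⟨ C.+-identityʳ _ ⟩
  (f *ˢ (h ∘ suc)) n                                   ∎
  where
  open ≈-Reasoning C.setoid
  term : Fin (suc (suc n)) → ℂ
  term i = f (toℕ i) *ᶜ h (suc n ∸ toℕ i)
  init≈ : ∀ i → term (inject₁ i) ≈ᶜ f (toℕ i) *ᶜ h (suc (n ∸ toℕ i))
  init≈ i = C.reflexive (≡.trans
    (cong (λ m → f m *ᶜ h (suc n ∸ m)) (toℕ-inject₁ i))
    (cong (λ m → f (toℕ i) *ᶜ h m) (ℕ.+-∸-assoc 1 (toℕ≤pred[n] i))))
  last≈0 : term (Fin.fromℕ (suc n)) ≈ᶜ 0ᶜ
  last≈0 = C.trans
    (C.reflexive (cong (λ m → f m *ᶜ h (suc n ∸ m)) (toℕ-fromℕ (suc n))))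
    (C.trans (C.*-congˡ (C.trans (C.reflexive (cong h (ℕ.n∸n≡0 n))) h₀≈0)) (C.zeroʳ (f (suc n))))

-- If D h = 0, then D₀ h₀ = 0 and D₀ h₁ + D₁ h₀ = 0, so h₀² is annihilated by D₀ and by D₁.
*ˢ-nonZeroDivisor : ∀ {D} → (∀ z → D 0 *ᶜ z ≈ᶜ 0ᶜ → D 1 *ᶜ z ≈ᶜ 0ᶜ → z ≈ᶜ 0ᶜ) →
                    ∀ {h} → (∀ n → (D *ˢ h) n ≈ᶜ 0ᶜ) → ∀ n → h n ≈ᶜ 0ᶜ
*ˢ-nonZeroDivisor {D} faithful {h} Dh≈0 = λ where
    zero    → h₀≈0
    -- Now that h₀ = 0, D annihilates the shifted series too, and the argument repeats with the next
    -- coefficient.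
    (suc n) → *ˢ-nonZeroDivisor {D} faithful {h ∘ suc} (λ m → C.trans (C.sym (*ˢ-tail D {h} h₀≈0 m)) (Dh≈0 (suc m))) n
  where
  open ≈-Reasoning C.setoid
  open ℂ-solver
  D₀h₀≈0 : D 0 *ᶜ h 0 ≈ᶜ 0ᶜ
  D₀h₀≈0 = C.trans (C.sym (C.+-identityʳ _)) (Dh≈0 0)
  h₀≈0 : h 0 ≈ᶜ 0ᶜ
  h₀≈0 = z²≈0⇒z≈0 (faithful (h 0 *ᶜ h 0)
    (begin
      D 0 *ᶜ (h 0 *ᶜ h 0)   ≈⟨ C.*-assoc (D 0) (h 0) (h 0) ⟨
      D 0 *ᶜ h 0 *ᶜ h 0     ≈⟨ C.*-congʳ D₀h₀≈0 ⟩
      0ᶜ *ᶜ h 0             ≈⟨ C.zeroˡ (h 0) ⟩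
      0ᶜ                    ∎)
    (begin
      D 1 *ᶜ (h 0 *ᶜ h 0)
        -- The `con 0ℚ` is the empty end of the two-term convolution (D h)₁.
        ≈⟨ solve 4 (λ a b x y → b :* (x :* x) := x :* (a :* y :+ (b :* x :+ con 0ℚ)) :- y :* (a :* x)) C.refl (D 0) (D 1) (h 0) (h 1) ⟩
      h 0 *ᶜ (D *ˢ h) 1 +ᶜ -ᶜ (h 1 *ᶜ (D 0 *ᶜ h 0))
        ≈⟨ C.+-cong (C.*-congˡ (Dh≈0 1)) (C.-‿cong (C.*-congˡ D₀h₀≈0)) ⟩
      h 0 *ᶜ 0ᶜ +ᶜ -ᶜ (h 1 *ᶜ 0ᶜ)
        ≈⟨ solve 2 (λ x y → x :* con 0ℚ :- y :* con 0ℚ := con 0ℚ) C.refl (h 0) (h 1) ⟩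
      0ᶜ ∎))

*ˢ-cancelˡ : ∀ {D} → (∀ z → D 0 *ᶜ z ≈ᶜ 0ᶜ → D 1 *ᶜ z ≈ᶜ 0ᶜ → z ≈ᶜ 0ᶜ) →
             ∀ {f g} → D *ˢ f ≋ D *ˢ g → f ≋ g
*ˢ-cancelˡ {D} faithful {f} {g} Df≋Dg n = C.x∙y⁻¹≈ε⇒x≈y (f n) (g n)
  (*ˢ-nonZeroDivisor {D} faithful {f -ˢ g} (λ m → C.trans (*ˢ-distribˡ--ˢ D f g m)
    (C.trans (C.+-congʳ (Df≋Dg m)) (C.-‿inverseʳ _))) n)

-- Dilation of power series.

-- f(ct)
scale : ℂ → Series → Series
scale c f n = c ^ᶜ n *ᶜ f n

scale-cong : ∀ c {f g} → f ≋ g → scale c f ≋ scale c g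
scale-cong c f≋g n = C.*-congˡ (f≋g n)

-- In every summand of the convolution the two exponents of c add up to n.
scale-* : ∀ c f g → scale c f *ˢ scale c g ≋ scale c (f *ˢ g)
scale-* c f g n = C.trans (∑ᶜ-cong {suc n} eq)
  (C.sym (C.*-distribˡ-sum {suc n} (c ^ᶜ n) (λ i → f (toℕ i) *ᶜ g (n ∸ toℕ i))))
  where
  open ≈-Reasoning C.setoid
  open ℂ-solver
  eq : ∀ i → scale c f (toℕ i) *ᶜ scale c g (n ∸ toℕ i) ≈ᶜ c ^ᶜ n *ᶜ (f (toℕ i) *ᶜ g (n ∸ toℕ i))
  eq i = begin
    c ^ᶜ k *ᶜ f k *ᶜ (c ^ᶜ l *ᶜ g l)    ≈⟨ solve 4 (λ p x q y → p :* x :* (q :* y) := p :* q :* (x :* y)) C.refl (c ^ᶜ k) (f k) (c ^ᶜ l) (g l) ⟩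
    c ^ᶜ k *ᶜ c ^ᶜ l *ᶜ (f k *ᶜ g l)    ≈⟨ C.*-congʳ (C.^-homo-* c k l) ⟨
    c ^ᶜ (k ℕ.+ l) *ᶜ (f k *ᶜ g l)      ≡⟨ cong (λ m → c ^ᶜ m *ᶜ (f k *ᶜ g l)) (ℕ.m+[n∸m]≡n (toℕ≤pred[n] i)) ⟩
    c ^ᶜ n *ᶜ (f k *ᶜ g l)              ∎
    where
    k = toℕ i
    l = n ∸ k

scale-const : ∀ c x → scale c (const x) ≋ const x
scale-const c x zero    = C.*-identityˡ x
scale-const c x (suc n) = C.zeroʳ (c ^ᶜ suc n)

scale-const-*ˢ : ∀ c x f → scale c (const x *ˢ f) ≋ x • scale c f
scale-const-*ˢ c x f n = C.trans (C.*-congˡ (const-*ˢ x f n))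
  (solve 3 (λ p x y → p :* (x :* y) := x :* (p :* y)) C.refl (c ^ᶜ n) x (f n))
  where open ℂ-solver

•-*ˢ : ∀ c f g → (c • f) *ˢ g ≋ c • (f *ˢ g)
•-*ˢ c f g n = C.trans
  (∑ᶜ-cong {suc n} λ i → C.*-assoc c (f (toℕ i)) (g (n ∸ toℕ i)))
  (C.sym (C.*-distribˡ-sum {suc n} c (λ i → f (toℕ i) *ᶜ g (n ∸ toℕ i))))

-- The hypothesis makes p homogeneous of degree one, and degrees add under multiplication.
scale-^ : ∀ c {p} → scale c p ≋ c • p → ∀ k → scale c (p ^ˢ k) ≋ (c ^ᶜ k) • (p ^ˢ k)
scale-^ c hom zero    n = C.trans (scale-const c 1ᶜ n) (C.sym (C.*-identityˡ _))
scale-^ c {p} hom (suc k) n = begin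
  scale c (p *ˢ p ^ˢ k) n               ≈⟨ scale-* c p (p ^ˢ k) n ⟨
  (scale c p *ˢ scale c (p ^ˢ k)) n     ≈⟨ *ˢ-cong {scale c p} {c • p} {scale c (p ^ˢ k)} {(c ^ᶜ k) • (p ^ˢ k)} hom (scale-^ c {p} hom k) n ⟩
  ((c • p) *ˢ ((c ^ᶜ k) • (p ^ˢ k))) n  ≈⟨ •-*ˢ c p ((c ^ᶜ k) • (p ^ˢ k)) n ⟩
  c *ᶜ (p *ˢ ((c ^ᶜ k) • (p ^ˢ k))) n   ≈⟨ C.*-congˡ (*ˢ-• (c ^ᶜ k) p (p ^ˢ k) n) ⟩
  c *ᶜ (c ^ᶜ k *ᶜ (p *ˢ p ^ˢ k) n)      ≈⟨ C.*-assoc c (c ^ᶜ k) ((p *ˢ p ^ˢ k) n) ⟨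
  ((c ^ᶜ suc k) • (p *ˢ p ^ˢ k)) n      ∎
  where open ≈-Reasoning C.setoid

-- With c = d, this homogeneity is the source of d⁻ᵏ in the final formula.
scale-2[t/2]^ : ∀ c k → scale c (2[t/2]^ k) ≋ (c ^ᶜ k) • 2[t/2]^ k
scale-2[t/2]^ c k n = begin
  scale c (const 2ᶜ *ˢ p ^ˢ k) n          ≈⟨ scale-const-*ˢ c 2ᶜ (p ^ˢ k) n ⟩
  2ᶜ *ᶜ scale c (p ^ˢ k) n                ≈⟨ C.*-congˡ (scale-^ c {p} linear k n) ⟩
  2ᶜ *ᶜ (c ^ᶜ k *ᶜ (p ^ˢ k) n)            ≈⟨ solve 3 (λ x y z → x :* (y :* z) := y :* (x :* z)) C.refl 2ᶜ (c ^ᶜ k) ((p ^ˢ k) n) ⟩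
  c ^ᶜ k *ᶜ (2ᶜ *ᶜ (p ^ˢ k) n)            ≈⟨ C.*-congˡ (const-*ˢ 2ᶜ (p ^ˢ k) n) ⟨
  c ^ᶜ k *ᶜ (const 2ᶜ *ˢ p ^ˢ k) n        ∎
  where
  open ≈-Reasoning C.setoid
  open ℂ-solver
  2ᶜ ½ᶜ : ℂ
  2ᶜ = fromℚᶜ (fromℕ 2)
  ½ᶜ = fromℚᶜ ½
  p : Series
  p = const ½ᶜ *ˢ t
  scale-t : scale c t ≋ c • t
  scale-t 0             = solve 1 (λ c → con 1ℚ :* con 0ℚ := c :* con 0ℚ) C.refl c
  scale-t 1             = solve 1 (λ c → c :* con 1ℚ :* con 1ℚ := c :* con 1ℚ) C.refl c
  scale-t (suc (suc n)) = C.trans (C.zeroʳ (c ^ᶜ suc (suc n))) (C.sym (C.zeroʳ c))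
  linear : scale c p ≋ c • p
  linear m = begin
    scale c p m               ≈⟨ scale-const-*ˢ c ½ᶜ t m ⟩
    ½ᶜ *ᶜ scale c t m         ≈⟨ C.*-congˡ (scale-t m) ⟩
    ½ᶜ *ᶜ (c *ᶜ t m)          ≈⟨ solve 3 (λ x y z → x :* (y :* z) := y :* (x :* z)) C.refl ½ᶜ c (t m) ⟩
    c *ᶜ (½ᶜ *ᶜ t m)          ≈⟨ C.*-congˡ (const-*ˢ ½ᶜ t m) ⟨
    c *ᶜ p m                  ∎

-- Relating x and y by an equation in ℂ leaves y free to be any real that represents the product,
-- such as `fromℕʳ d`.
scale-exp : ∀ c {x y} → c *ᶜ fromℝ x ≈ᶜ fromℝ y → scale c exp[ x ·t] ≋ exp[ y ·t]
scale-exp c {x} {y} cx≈y n = begin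
  c ^ᶜ n *ᶜ (1/n! *ᶜ fromℝ x ^ᶜ n)   ≈⟨ solve 3 (λ p q r → p :* (q :* r) := q :* (p :* r)) C.refl (c ^ᶜ n) 1/n! (fromℝ x ^ᶜ n) ⟩
  1/n! *ᶜ (c ^ᶜ n *ᶜ fromℝ x ^ᶜ n)   ≈⟨ C.*-congˡ (C.^-distrib-* c (fromℝ x) n) ⟨
  1/n! *ᶜ (c *ᶜ fromℝ x) ^ᶜ n        ≈⟨ C.*-congˡ (C.^-congˡ n cx≈y) ⟩
  1/n! *ᶜ fromℝ y ^ᶜ n               ∎
  where
  open ≈-Reasoning C.setoid
  open ℂ-solver
  1/n! = fromℚᶜ (1/ n !)

const-cong : ∀ {x y} → x ≈ᶜ y → const x ≋ const y
const-cong x≈y zero    = x≈y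
const-cong x≈y (suc _) = C.refl

-- Combining the dilated expansions.

-- In use q = dⁿ and i = 1/n!, the factors shared by the nth coefficients of all dilated generating
-- functions.
factor : ∀ {m} (c y : Fin m → ℂ) q i → (∑ᶜ λ j → c j *ᶜ (q *ᶜ (i *ᶜ y j))) ≈ᶜ q *ᶜ i *ᶜ ∑ᶜ λ j → c j *ᶜ y j
factor {m} c y q i = C.trans
  (∑ᶜ-cong λ j → solve 4 (λ c q i y → c :* (q :* (i :* y)) := q :* i :* (c :* y)) C.refl (c j) q i (y j))
  (C.sym (C.*-distribˡ-sum {m} (q *ᶜ i) (λ j → c j *ᶜ y j)))
  where open ℂ-solver

-- In use i = 1/n! has inverse f = n!, p = dᵏ has inverse ε = d⁻ᵏ, q = dⁿ and P = dⁿ⁻ᵏ. Multiply the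
-- last hypothesis by fε.
cancel-units : ∀ {f i ε p P q Y S} → f *ᶜ i ≈ᶜ 1ᶜ → ε *ᶜ p ≈ᶜ 1ᶜ → P *ᶜ p ≈ᶜ q →
               q *ᶜ i *ᶜ S ≈ᶜ p *ᶜ (i *ᶜ Y) → Y ≈ᶜ P *ᶜ S
cancel-units {f} {i} {ε} {p} {P} {q} {Y} {S} fi≈1 εp≈1 Pp≈q h = begin
  Y                                       ≈⟨ solve 1 (λ y → y := con 1ℚ :* con 1ℚ :* y) C.refl Y ⟩
  1ᶜ *ᶜ 1ᶜ *ᶜ Y                           ≈⟨ C.*-congʳ (C.*-cong fi≈1 εp≈1) ⟨
  f *ᶜ i *ᶜ (ε *ᶜ p) *ᶜ Y                 ≈⟨ solve 5 (λ f i ε p y → f :* i :* (ε :* p) :* y := f :* ε :* (p :* (i :* y))) C.refl f i ε p Y ⟩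
  f *ᶜ ε *ᶜ (p *ᶜ (i *ᶜ Y))               ≈⟨ C.*-congˡ h ⟨
  f *ᶜ ε *ᶜ (q *ᶜ i *ᶜ S)                 ≈⟨ C.*-congˡ (C.*-congʳ (C.*-congʳ Pp≈q)) ⟨
  f *ᶜ ε *ᶜ (P *ᶜ p *ᶜ i *ᶜ S)            ≈⟨ solve 6 (λ f ε P p i S → f :* ε :* (P :* p :* i :* S) := f :* i :* (ε :* p) :* (P :* S)) C.refl f ε P p i S ⟩
  f *ᶜ i *ᶜ (ε *ᶜ p) *ᶜ (P *ᶜ S)          ≈⟨ C.*-congʳ (C.*-cong fi≈1 εp≈1) ⟩
  1ᶜ *ᶜ 1ᶜ *ᶜ (P *ᶜ S)                    ≈⟨ solve 1 (λ y → con 1ℚ :* con 1ℚ :* y := y) C.refl (P *ᶜ S) ⟩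
  P *ᶜ S                                  ∎
  where
  open ≈-Reasoning C.setoid
  open ℂ-solver

-- The denominators D′ become the common denominator D = D′(δt), which then cancels.
rescaled-expansions : ∀ {m δ q D D′ N F} {c : Fin m → ℂ} {E H G : Fin m → Series} →
  (∀ z → D 0 *ᶜ z ≈ᶜ 0ᶜ → D 1 *ᶜ z ≈ᶜ 0ᶜ → z ≈ᶜ 0ᶜ) →
  scale δ D′ ≋ D → scale δ N ≋ q • N → (∀ j → scale δ (H j) ≋ E j) →
  F expands N *ˢ ∑ˢ (λ j → const (c j) *ˢ E j) ÷ D →
  (∀ j → G j expands N *ˢ H j ÷ D′) →
  (λ n → ∑ᶜ λ j → (c j • scale δ (G j)) n) ≋ q • F
rescaled-expansions {m} {δ} {q} {D} {D′} {N} {F} {c} {E} {H} {G} faithful D′≋D N-hom H≋E F-expands G-expands =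
  -- Both sides are compared after multiplication by D: each then becomes q times the numerator of
  -- F.
  *ˢ-cancelˡ {D} faithful {λ n → ∑ᶜ λ j → (c j • scale δ (G j)) n} {q • F} λ n → begin
    (D *ˢ (λ l → ∑ᶜ λ j → (c j • scale δ (G j)) l)) n   ≈⟨ *ˢ-∑-• D c (λ j → scale δ (G j)) n ⟩
    (∑ᶜ λ j → c j *ᶜ (D *ˢ scale δ (G j)) n)            ≈⟨ ∑ᶜ-cong (λ j → C.trans (C.*-congˡ (scaled j n))
      (solve 3 (λ x y z → x :* (y :* z) := y :* (x :* z)) C.refl (c j) q ((N *ˢ E j) n))) ⟩
    (∑ᶜ λ j → q *ᶜ (c j *ᶜ (N *ˢ E j) n))               ≈⟨ C.*-distribˡ-sum {m} q (λ j → c j *ᶜ (N *ˢ E j) n) ⟨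
    q *ᶜ (∑ᶜ λ j → c j *ᶜ (N *ˢ E j) n)                 ≈⟨ C.*-congˡ (numerator n) ⟨
    q *ᶜ (N *ˢ ∑ˢ (λ j → const (c j) *ˢ E j)) n         ≈⟨ C.*-congˡ (F-expands n) ⟨
    q *ᶜ (D *ˢ F) n                                     ≈⟨ *ˢ-• q D F n ⟨
    (D *ˢ (q • F)) n                                    ∎
  where
  open ≈-Reasoning C.setoid
  open ℂ-solver
  numerator : ∀ n → (N *ˢ ∑ˢ (λ j → const (c j) *ˢ E j)) n ≈ᶜ ∑ᶜ λ j → c j *ᶜ (N *ˢ E j) n
  numerator n = C.trans
    (*ˢ-cong {N} {N} {∑ˢ (λ j → const (c j) *ˢ E j)} {λ l → ∑ᶜ λ j → (c j • E j) l} (λ _ → C.refl)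
      (λ l → C.trans (∑ˢ-coeff (λ j → const (c j) *ˢ E j) l) (∑ᶜ-cong λ j → const-*ˢ (c j) (E j) l)) n)
    (*ˢ-∑-• N c E n)
  scaled : ∀ j n → (D *ˢ scale δ (G j)) n ≈ᶜ q *ᶜ (N *ˢ E j) n
  scaled j n = begin
    -- As D is the dilation of D′, this product is the dilation of D′ Gⱼ, to which the expansion of
    -- Gⱼ applies.
    (D *ˢ scale δ (G j)) n            ≈⟨ *ˢ-cong {scale δ D′} {D} {scale δ (G j)} {scale δ (G j)} D′≋D (λ _ → C.refl) n ⟨
    (scale δ D′ *ˢ scale δ (G j)) n   ≈⟨ scale-* δ D′ (G j) n ⟩
    scale δ (D′ *ˢ G j) n             ≈⟨ scale-cong δ {D′ *ˢ G j} {N *ˢ H j} (G-expands j) n ⟩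
    scale δ (N *ˢ H j) n              ≈⟨ scale-* δ N (H j) n ⟨
    (scale δ N *ˢ scale δ (H j)) n    ≈⟨ *ˢ-cong {scale δ N} {q • N} {scale δ (H j)} {E j} N-hom (H≋E j) n ⟩
    ((q • N) *ˢ E j) n                ≈⟨ •-*ˢ q N (E j) n ⟩
    q *ᶜ (N *ˢ E j) n                 ∎

-- Dilation by d: denominators, exponentials and coefficients.

module _ (d : ℕ) .{{_ : NonZero d}} where
  private
    δ 1/d : ℂ
    δ   = fromℚᶜ (fromℕ d)
    1/d = fromℚᶜ (+ 1 / d)

    1/d*δ≈1 : 1/d *ᶜ δ ≈ᶜ 1ᶜ
    1/d*δ≈1 = fromℚᶜ-inverse (1/-inverse 1 d)

  -- Dilation fixes constants and turns eᵗ into eᵈᵗ. A′ and B′ are the powers formed from aᵈ and βᵈ,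
  -- A and B those formed from a and β.
  scale-denominator : ∀ {A A′ B B′} → A′ ≈ᶜ A → B′ ≈ᶜ B →
    scale δ (const B′ *ˢ exp[ 1ʳ ·t] -ˢ const A′) ≋ const B *ˢ exp[ fromℕʳ d ·t] -ˢ const A
  scale-denominator {A} {A′} {B} {B′} A′≈A B′≈B n = begin
    δ ^ᶜ n *ᶜ ((const B′ *ˢ exp[ 1ʳ ·t]) n +ᶜ -ᶜ const A′ n)
      ≈⟨ solve 3 (λ x y z → x :* (y :- z) := x :* y :- x :* z) C.refl (δ ^ᶜ n) ((const B′ *ˢ exp[ 1ʳ ·t]) n) (const A′ n) ⟩
    scale δ (const B′ *ˢ exp[ 1ʳ ·t]) n +ᶜ -ᶜ scale δ (const A′) n
      ≈⟨ C.+-cong (scale-const-*ˢ δ B′ exp[ 1ʳ ·t] n) (C.-‿cong (scale-const δ A′ n)) ⟩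
    B′ *ᶜ scale δ exp[ 1ʳ ·t] n +ᶜ -ᶜ const A′ n
      ≈⟨ C.+-cong (C.*-cong B′≈B (scale-exp δ {1ʳ} {fromℕʳ d} (C.*-identityʳ δ) n)) (C.-‿cong (const-cong A′≈A n)) ⟩
    B *ᶜ exp[ fromℕʳ d ·t] n +ᶜ -ᶜ const A n
      ≈⟨ C.+-congʳ (const-*ˢ B exp[ fromℕʳ d ·t] n) ⟨
    (const B *ˢ exp[ fromℕʳ d ·t]) n +ᶜ -ᶜ const A n ∎
    where
    open ≈-Reasoning C.setoid
    open ℂ-solver

  -- D = B e^(dt) - A has D₀ = B - A and D₁ = dB, and A = D₁ / d - D₀ is invertible.
  denominator-faithful : ∀ {A A⁻¹ B} → A⁻¹ *ᶜ A ≈ᶜ 1ᶜ → let D = const B *ˢ exp[ fromℕʳ d ·t] -ˢ const A in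
    ∀ z → D 0 *ᶜ z ≈ᶜ 0ᶜ → D 1 *ᶜ z ≈ᶜ 0ᶜ → z ≈ᶜ 0ᶜ
  denominator-faithful {A} {A⁻¹} {B} A⁻¹A≈1 z D₀z≈0 D₁z≈0 = begin
    z                                                 ≈⟨ C.*-identityˡ z ⟨
    1ᶜ *ᶜ z                                           ≈⟨ C.*-congʳ A⁻¹A≈1 ⟨
    -- The explicit 1 before B z is about to become (1/d) d, which turns B z into D₁ z / d.
    A⁻¹ *ᶜ A *ᶜ z                                     ≈⟨ solve 4 (λ A A⁻¹ B z → A⁻¹ :* A :* z := A⁻¹ :* (con 1ℚ :* (B :* z) :- (B :- A) :* z)) C.refl A A⁻¹ B z ⟩
    A⁻¹ *ᶜ (1ᶜ *ᶜ (B *ᶜ z) +ᶜ -ᶜ ((B +ᶜ -ᶜ A) *ᶜ z))  ≈⟨ C.*-congˡ (C.+-cong (C.*-congʳ (C.sym 1/d*δ≈1)) (C.-‿cong (C.*-congʳ (C.sym D₀≈)))) ⟩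
    A⁻¹ *ᶜ (1/d *ᶜ δ *ᶜ (B *ᶜ z) +ᶜ -ᶜ (D 0 *ᶜ z))    ≈⟨ solve 6 (λ A⁻¹ e δ B z w → A⁻¹ :* (e :* δ :* (B :* z) :- w) := A⁻¹ :* (e :* (B :* δ :* z) :- w)) C.refl A⁻¹ 1/d δ B z (D 0 *ᶜ z) ⟩
    A⁻¹ *ᶜ (1/d *ᶜ (B *ᶜ δ *ᶜ z) +ᶜ -ᶜ (D 0 *ᶜ z))    ≈⟨ C.*-congˡ (C.+-cong (C.*-congˡ (C.trans (C.*-congʳ (C.sym D₁≈)) D₁z≈0)) (C.-‿cong D₀z≈0)) ⟩
    A⁻¹ *ᶜ (1/d *ᶜ 0ᶜ +ᶜ -ᶜ 0ᶜ)                       ≈⟨ solve 2 (λ x y → x :* (y :* con 0ℚ :- con 0ℚ) := con 0ℚ) C.refl A⁻¹ 1/d ⟩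
    0ᶜ                                                ∎
    where
    open ≈-Reasoning C.setoid
    open ℂ-solver
    D : Series
    D = const B *ˢ exp[ fromℕʳ d ·t] -ˢ const A
    D₀≈ : D 0 ≈ᶜ B +ᶜ -ᶜ A
    D₀≈ = C.+-congʳ (C.trans (const-*ˢ B exp[ fromℕʳ d ·t] 0)
      (solve 1 (λ B → B :* (con 1ℚ :* con 1ℚ) := B) C.refl B))
    D₁≈ : D 1 ≈ᶜ B *ᶜ δ
    -- The coefficient of t in eᵈᵗ is d / 1!, and `const A` contributes 0.
    D₁≈ = C.trans (C.+-congʳ (const-*ˢ B exp[ fromℕʳ d ·t] 1))
      (solve 2 (λ B δ → B :* (con 1ℚ :* (δ :* con 1ℚ)) :- con 0ℚ := B :* δ) C.refl B δ)

  scale-exp-/ : ∀ u → scale δ exp[ u *ʳ fromℚ (+ 1 / d) ·t] ≋ exp[ u ·t]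
  scale-exp-/ u = scale-exp δ {u *ʳ fromℚ (+ 1 / d)} {u} (begin
    δ *ᶜ fromℝ (u *ʳ fromℚ (+ 1 / d))  ≈⟨ C.*-congˡ (fromℝ-* u (fromℚ (+ 1 / d))) ⟩
    δ *ᶜ (fromℝ u *ᶜ 1/d)              ≈⟨ solve 3 (λ δ u e → δ :* (u :* e) := e :* δ :* u) C.refl δ (fromℝ u) 1/d ⟩
    1/d *ᶜ δ *ᶜ fromℝ u                ≈⟨ C.*-congʳ 1/d*δ≈1 ⟩
    1ᶜ *ᶜ fromℝ u                      ≈⟨ C.*-identityˡ (fromℝ u) ⟩
    fromℝ u                            ∎)
    where
    open ≈-Reasoning C.setoid
    open ℂ-solver

  -- The nth coefficient carries dⁿ/n! on the left and dᵏ/n! on the right; the quotient of these is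
  -- the power in the formula.
  compare-coefficients : ∀ n k {c : Fin d → ℂ} {y : Fin d → ℕ → ℂ} {Y} →
    (∑ᶜ λ j → (c j • scale δ (egf (y j))) n) ≈ᶜ δ ^ᶜ k *ᶜ egf Y n →
    Y n ≈ᶜ fromℚᶜ (d ^ᶻ (+ n - + k)) *ᶜ ∑ᶜ (λ j → c j *ᶜ y j n)
  compare-coefficients n k {c} {y} {Y} h = cancel-units
    {fromℚᶜ (fromℕ (n ℕ.!))} {fromℚᶜ (1/ n !)} {fromℚᶜ (d ^ᶻ (+ 0 - + k))} {δ ^ᶜ k}
    {fromℚᶜ (d ^ᶻ (+ n - + k))} {δ ^ᶜ n} {Y n} {∑ᶜ (λ j → c j *ᶜ y j n)}
    (fromℚᶜ-inverse (≡.trans (ℚ.*-comm (fromℕ (n ℕ.!)) (1/ n !)) (1/-inverse 1 (n ℕ.!) {{n ℕ.!≢0}})))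
    (^ᶻ-difference d 0 k)
    (^ᶻ-difference d n k)
    (C.trans (C.sym (factor c (λ j → y j n) (δ ^ᶜ n) (fromℚᶜ (1/ n !)))) h)

-- The multiplication formula.

-- The power aᵈ is a variable: at a ^ʳ d itself, conversion unfolds the logarithm and does not finish.
multiplication-formula : ∀ {d} .{{_ : NonZero d}} n k χ {a aᵈ b} (0<a : 0ʳ <ʳ a) (0<aᵈ : 0ʳ <ʳ aᵈ) → aᵈ ≈ʳ a ^ʳ d →
  ∀ {β} (logβ : Log β) x {Y} → IsGeneralizedY d χ logβ x k a 0<a b Y →
  (y : Fin d → ℕ → ℂ) →
  (∀ j → IsY (logβ ^Log d) ((x +ʳ fromℕʳ (toℕ j)) *ʳ fromℚ (+ 1 / d)) k aᵈ 0<aᵈ b (y j)) →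
  Y n ≈ᶜ fromℚᶜ (d ^ᶻ (+ n - + k)) *ᶜ
         ∑ᶜ {d} (λ j → χ (+ toℕ j) *ᶜ ratioPow logβ a 0<a b (toℕ j) *ᶜ y j n)
multiplication-formula {d} n k χ {a} {aᵈ} {b} 0<a 0<aᵈ aᵈ≈ logβ x {Y} Y-expands y y-expands =
  compare-coefficients d n k {λ j → χ (+ toℕ j) *ᶜ ratioPow logβ a 0<a b (toℕ j)} {y} {Y}
    (rescaled-expansions {d} {fromℚᶜ (fromℕ d)} {fromℚᶜ (fromℕ d) ^ᶜ k}
      {const (cpow logβ b d) *ˢ exp[ fromℕʳ d ·t] -ˢ const (fromℝ (rpow a 0<a (b *ʳ fromℕʳ d)))}
      {const (cpow (logβ ^Log d) b 1) *ˢ exp[ 1ʳ ·t] -ˢ const (fromℝ (rpow aᵈ 0<aᵈ b))}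
      {2[t/2]^ k} {egf Y} {λ j → χ (+ toℕ j) *ᶜ ratioPow logβ a 0<a b (toℕ j)}
      {λ j → exp[ x +ʳ fromℕʳ (toℕ j) ·t]} {λ j → exp[ (x +ʳ fromℕʳ (toℕ j)) *ʳ fromℚ (+ 1 / d) ·t]} {λ j → egf (y j)}
      -- Here A is the real power with exponent bd, and the power with exponent -bd is its inverse.
      (denominator-faithful d
        {fromℝ (rpow a 0<a (b *ʳ fromℕʳ d))} {fromℝ (rpow a 0<a (-ʳ (b *ʳ fromℕʳ d)))} {cpow logβ b d}
        (C.trans (C.sym (fromℝ-* (rpow a 0<a (-ʳ (b *ʳ fromℕʳ d))) (rpow a 0<a (b *ʳ fromℕʳ d))))
          (fromℝ-cong (rpow-inverse a 0<a (b *ʳ fromℕʳ d)))))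
      (scale-denominator d
        {fromℝ (rpow a 0<a (b *ʳ fromℕʳ d))} {fromℝ (rpow aᵈ 0<aᵈ b)} {cpow logβ b d} {cpow (logβ ^Log d) b 1}
        (fromℝ-cong {rpow aᵈ 0<aᵈ b} {rpow a 0<a (b *ʳ fromℕʳ d)} (rpow-^ 0<a 0<aᵈ d b aᵈ≈))
        (cpow-^Log logβ b d))
      (scale-2[t/2]^ (fromℚᶜ (fromℕ d)) k)
      (λ j → scale-exp-/ d (x +ʳ fromℕʳ (toℕ j)))
      Y-expands y-expands n)

theorem8 : (n k d : ℕ) → .{{_ : NonZero n}} → .{{_ : NonZero k}} → .{{_ : NonZero d}} →
    (χ : ℤ → ℂ) → HasConductor d χ →
    (a b : ℝ) (0<a : 0ʳ <ʳ a) → 0ʳ <ʳ b →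
    (β : ℂ) (logβ : Log β) (x : ℝ) →
    (yχ : ℕ → ℂ) → IsGeneralizedY d χ logβ x k a 0<a b yχ →
    (y : Fin d → ℕ → ℂ) →
    (∀ j → IsY (logβ ^Log d) ((x +ʳ fromℕʳ (toℕ j)) *ʳ fromℚ (+ 1 / d))
    k (a ^ʳ d) (^ʳ-pos d 0<a) b (y j)) →
    yχ n ≈ᶜ fromℚᶜ (d ^ᶻ (+ n - + k)) *ᶜ
    ∑ᶜ {d} (λ j → χ (+ toℕ j) *ᶜ ratioPow logβ a 0<a b (toℕ j) *ᶜ y j n)
theorem8 n k d χ _ a b 0<a _ β logβ x yχ yχ-expands y y-expands =
  -- The variable aᵈ becomes `a ^ʳ d` itself, so its defining equation is reflexivity.
  multiplication-formula n k χ 0<a (^ʳ-pos d 0<a) R.refl logβ x yχ-expands y y-expands
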